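{- Let $\varphi$ be a non-erasing morphism on a finite alphabet $\mathcal A$ such that: $\varphi(x)\ne\varphi(y)$ for all distinct letters $x,y$; $\varphi(x)$ is a primitive word for every letter $x$; and for any three distinct letters $a,b,c$ and integers $\alpha,\beta,\gamma$, if $\varphi(a)^\alpha\varphi(b)^\beta\varphi(c)^\gamma=\varepsilon$ (in the free group) then $\alpha\beta\gamma=0$. If $\varphi$ preserves richness, then $\varphi$ is of class $P$.
   Context: A finite word $w$ is rich if it has exactly $|w|+1$ distinct palindromic factors (including the empty word); an infinite word is rich if all its factors are rich. $\varphi$ preserves richness if $\varphi(w)$ is rich whenever $w\in\mathcal A^*\cup\mathcal A^\omega$ is rich. A word is primitive if it is not a power of a shorter word. A morphism $\varphi$ on $\mathcal A$ is a standard $P$-morphism if there is a palindrome $p$ (possibly empty) such that for every $x\in\mathcal A$, $\varphi(x)=pq_x$ where each $q_x$ is a palindrome (possibly empty), or, when $p$ is non-empty, $q_x=\pi_x^{ -1}$ with $\pi_x$ a proper palindromic suffix of $p$ (meaning $\varphi(x)$ is $p$ with the suffix $\pi_x$ removed). A morphism $\psi$ is of class $P$ if there is a standard $P$-morphism $\varphi(x)=pq_x$ and a factorization $p=p'p''$ with $\psi(x)=p''q_xp'$ for all $x\in\mathcal A$. -}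

module Defs where

open import Data.Nat using (ℕ; zero; suc; _+_; _<_; _≤_)
open import Data.Fin using (Fin)
open import Data.Fin.Properties using () renaming (_≟_ to _≟F_)
open import Data.Bool using (Bool; true; false; not; if_then_else_; _∧_)
open import Data.Bool.Properties using () renaming (_≟_ to _≟B_)
open import Data.Integer using (ℤ; +_; -[1+_]; _*_)
open import Data.List using (List; []; _∷_; _++_; length; reverse; map; concat; replicate;
  concatMap; filter; upTo; drop; take; deduplicate)
open import Data.List.Properties using (≡-dec)
open import Data.Product using (Σ; ∃; _×_; _,_; proj₁; proj₂)
open import Data.Sum using (_⊎_)
open import Data.Empty using (⊥)
open import Relation.Nullary using (¬_; does)
open import Relation.Nullary.Decidable using (Dec)
open import Relation.Binary.PropositionalEquality using (_≡_; _≢_)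

Word : ℕ → Set
Word k = List (Fin k)

InfWord : ℕ → Set
InfWord k = ℕ → Fin k

_≟W_ : ∀ {k} → (u v : Word k) → Dec (u ≡ v)
_≟W_ = ≡-dec _≟F_

Pal : ∀ {k} → Word k → Set
Pal w = reverse w ≡ w

factors : ∀ {k} → Word k → List (Word k)
factors [] = [] ∷ []
factors (a ∷ w) = map (λ n → take n (a ∷ w)) (upTo (suc (length (a ∷ w)))) ++ factors w

palFactors : ∀ {k} → Word k → List (Word k)
palFactors w = deduplicate _≟W_ (filter (λ u → reverse u ≟W u) (factors w))

Rich : ∀ {k} → Word k → Set
Rich w = length (palFactors w) ≡ suc (length w)

infFactor : ∀ {k} → InfWord k → ℕ → ℕ → Word k
infFactor u i n = map (λ j → u (i + j)) (upTo n)

RichInf : ∀ {k} → InfWord k → Set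
RichInf u = ∀ i n → Rich (infFactor u i n)

Morphism : ℕ → Set
Morphism k = Fin k → Word k

applyM : ∀ {k} → Morphism k → Word k → Word k
applyM φ w = concatMap φ w

IsImageInf : ∀ {k} → Morphism k → InfWord k → InfWord k → Set
IsImageInf φ w u = ∀ n → applyM φ (infFactor w 0 n) ≡ infFactor u 0 (length (applyM φ (infFactor w 0 n)))

PreservesRichness : ∀ {k} → Morphism k → Set
PreservesRichness φ =
  (∀ w → Rich w → Rich (applyM φ w)) ×
  (∀ w u → RichInf w → IsImageInf φ w u → RichInf u)

NonErasing : ∀ {k} → Morphism k → Set
NonErasing φ = ∀ x → φ x ≢ []

InjectiveOnLetters : ∀ {k} → Morphism k → Set
InjectiveOnLetters φ = ∀ x y → x ≢ y → φ x ≢ φ y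

Primitive : ∀ {k} → Word k → Set
Primitive w = ∀ (v : List _) (n : ℕ) → w ≡ concat (replicate n v) → ¬ (length v < length w)

-- Free group over Fin k: words over letters (a , true) = a, (a , false) = a⁻¹;
-- group elements are compared via their free reduction.

GWord : ℕ → Set
GWord k = List (Fin k × Bool)

embed : ∀ {k} → Word k → GWord k
embed = map (λ a → a , true)

ginv : ∀ {k} → GWord k → GWord k
ginv g = reverse (map (λ p → proj₁ p , not (proj₂ p)) g)

gpow : ∀ {k} → GWord k → ℤ → GWord k
gpow g (+ n) = concat (replicate n g)
gpow g -[1+ n ] = concat (replicate (suc n) (ginv g))

push : ∀ {k} → Fin k × Bool → GWord k → GWord k
push x [] = x ∷ []
push x (y ∷ ys) =
  if does (proj₁ x ≟F proj₁ y) ∧ not (does (proj₂ x ≟B proj₂ y))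
  then ys else x ∷ y ∷ ys

freeReduce : ∀ {k} → GWord k → GWord k
freeReduce [] = []
freeReduce (x ∷ g) = push x (freeReduce g)

IsTrivial : ∀ {k} → GWord k → Set
IsTrivial g = freeReduce g ≡ []

TripleCondition : ∀ {k} → Morphism k → Set
TripleCondition φ = ∀ a b c → a ≢ b → b ≢ c → a ≢ c → ∀ (α β γ : ℤ) →
  IsTrivial (gpow (embed (φ a)) α ++ gpow (embed (φ b)) β ++ gpow (embed (φ c)) γ) →
  α * β * γ ≡ + 0

-- proper suffix π of p, with p = r π ; then p π⁻¹ = r
-- StandardPShape p φx : φ(x) = p q_x with q_x a palindrome, or
-- p ≠ ε and φ(x) = p π_x⁻¹ with π_x a proper palindromic suffix of p.
StdImage : ∀ {k} → Word k → Word k → Set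
StdImage p φx =
  (∃ λ q → Pal q × φx ≡ p ++ q) ⊎
  (p ≢ [] × ∃ λ r → ∃ λ π → Pal π × length π < length p × p ≡ r ++ π × φx ≡ r)

StandardP : ∀ {k} → Morphism k → Set
StandardP {k} φ = ∃ λ (p : Word k) → Pal p × (∀ x → StdImage p (φ x))

-- ψ(x) = p'' q_x p' : for q_x a palindrome this is literal concatenation;
-- for q_x = π_x⁻¹ it is the free-group identity ψ(x) = p'' π_x⁻¹ p',
-- i.e. p' ψ(x) = p π_x⁻¹ p' = φ(x) p'.
ClassP : ∀ {k} → Morphism k → Set
ClassP {k} ψ = ∃ λ (p : Word k) → ∃ λ (p' : Word k) → ∃ λ (p'' : Word k) →
  Pal p × p ≡ p' ++ p'' × ∀ x →
    (∃ λ q → Pal q × ψ x ≡ p'' ++ q ++ p') ⊎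
    (p ≢ [] × ∃ λ r → ∃ λ π → Pal π × length π < length p × p ≡ r ++ π ×
       p' ++ ψ x ≡ r ++ p')

{-# OPTIONS --safe #-}
module Submission where

-- For letters a ≠ b put u = φ(a) and v = φ(b), and let t (resp. s) be the longest common prefix
-- (resp. suffix) of the periodic words with periods u and v. The words aᴹbⁿaᴸ with M ≤ L are rich,
-- hence so are uᴹvⁿuᴸ, and a rich word has a palindromic prefix that does not occur again. For
-- L > M ≫ n ≫ 0 such a prefix is centred at the centre of s vⁿ t, so s vⁿ t is a palindrome; since
-- s and t continue the period v, the words s v t and s t are palindromes too. If one pair (s , t)
-- works for all letters, then φ is of class P with p′ = s and p″ = t. Choose the pair a, b
-- minimising |s| + |t|. By the ultrametric inequality for common prefixes and suffixes, a letter c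
-- for which this (s , t) fails would have, up to exchanging a and b, a longer common suffix with a
-- and a longer common prefix with b; comparing axes of symmetry, the excesses are powers φ(a)ʲ and
-- φ(b)ⁱ, and φ(b)ⁱφ(a)ʲ commutes with φ(c), hence is a power of φ(c). The triple condition forbids this.

open import Defs
open import Data.Bool using (false)
open import Data.Empty using (⊥; ⊥-elim)
open import Data.Fin using (Fin; zero; suc)
import Data.Fin.Properties as Fin
import Data.Integer as ℤ
open import Data.List using (List; []; _∷_; [_]; _++_; length; reverse; map; concat; replicate; upTo; take; drop)
open import Data.List.Membership.Propositional using (_∈_; _∉_; find)
open import Data.List.Membership.Propositional.Properties
open import Data.List.Properties
open import Data.List.Relation.Unary.All as All using (All)
open import Data.List.Relation.Unary.All.Properties using (¬All⇒Any¬)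
open import Data.List.Relation.Unary.AllPairs using ([]; _∷_)
open import Data.List.Relation.Unary.Any using (here; there)
open import Data.List.Relation.Unary.Unique.Propositional using (Unique)
open import Data.Nat using (ℕ; zero; suc; _+_; _*_; _∸_; _≤_; _<_; z≤n; s≤s; _≤?_; _<?_)
open import Data.Nat.Properties
open import Data.Product using (Σ; ∃; _×_; _,_; proj₁; proj₂; swap)
open import Data.Sum using (_⊎_; inj₁; inj₂)
open import Relation.Binary.Definitions using (tri<; tri≈; tri>)
open import Relation.Binary.PropositionalEquality hiding ([_])
open import Relation.Nullary using (¬_; Dec; yes; no; contradiction)
open import Tactic.MonoidSolver using (solve)

open ≡-Reasoning

private variable
  k : ℕ
  p q r u v w z : Word k

infix 4 _⊑_ _⊑ω_
infixl 8 _^_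

_^_ : Word k → ℕ → Word k
u ^ n = concat (replicate n u)

_⊑_ : Word k → Word k → Set
p ⊑ w = ∃ λ r → p ++ r ≡ w

-- w is a prefix of the infinite word uuu…
_⊑ω_ : Word k → Word k → Set
w ⊑ω u = ∃ λ n → w ⊑ u ^ n

-- Prefixes and factorisations of words.

++-split : ∀ (p q : Word k) {r s} → p ++ r ≡ q ++ s → length p ≤ length q →
  ∃ λ m → q ≡ p ++ m × r ≡ m ++ s
++-split []      q       eq le = q , refl , eq
++-split (x ∷ p) (y ∷ q) eq (s≤s le) with ∷-injective eq
... | refl , eq′ with ++-split p q eq′ le
... | m , refl , r≡ = m , refl , r≡

++-injective : ∀ (p q : Word k) {r s} → p ++ r ≡ q ++ s → length p ≡ length q → p ≡ q × r ≡ s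
++-injective p q eq len with ++-split p q eq (≤-reflexive len)
... | []    , refl , r≡ = sym (++-identityʳ p) , r≡
... | x ∷ m , refl , r≡ = contradiction len (<⇒≢ (subst (length p <_) (sym (length-++ p)) (m<m+n _ (s≤s z≤n))))

++-splitʳ : ∀ (r s : Word k) {p q} → r ++ p ≡ s ++ q → length p ≤ length q →
  ∃ λ m → q ≡ m ++ p × r ≡ s ++ m
++-splitʳ r s {p} {q} eq le with ≤-total (length s) (length r)
... | inj₁ s≤r with ++-split s r (sym eq) s≤r
... | m , r≡ , q≡ = m , q≡ , r≡
++-splitʳ r s {p} {q} eq le | inj₂ r≤s with ++-split r s eq r≤s
... | [] , refl , p≡ = [] , sym p≡ , sym (trans (++-identityʳ _) (++-identityʳ r))
... | x ∷ m , refl , refl = contradiction le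
  (<⇒≱ (subst (length q <_) (sym (length-++ (x ∷ m))) (m<n+m _ (s≤s z≤n))))

⊑-refl : w ⊑ w
⊑-refl {w = w} = [] , ++-identityʳ w

⊑-trans : p ⊑ q → q ⊑ r → p ⊑ r
⊑-trans {p = p} (a , refl) (b , refl) = a ++ b , sym (++-assoc p a b)

⊑-++ : ∀ (p q : Word k) → p ⊑ p ++ q
⊑-++ p q = q , refl

++-mono-⊑ : ∀ (u : Word k) → p ⊑ q → u ++ p ⊑ u ++ q
++-mono-⊑ {p = p} u (a , refl) = a , ++-assoc u p a

++-cancel-⊑ : ∀ (u : Word k) → u ++ p ⊑ u ++ q → p ⊑ q
++-cancel-⊑ {p = p} u (a , e) = a , ++-cancelˡ u _ _ (trans (sym (++-assoc u p a)) e)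

⊑⇒≤ : p ⊑ q → length p ≤ length q
⊑⇒≤ {p = p} (a , refl) = length-++-≤ˡ p

⊑-comparable : p ⊑ w → q ⊑ w → length p ≤ length q → p ⊑ q
⊑-comparable {p = p} {q = q} (a , e) (b , f) le with ++-split p q (trans e (sym f)) le
... | m , q≡ , _ = m , sym q≡

⊑-unique : p ⊑ w → q ⊑ w → length p ≡ length q → p ≡ q
⊑-unique {p = p} {q = q} (a , e) (b , f) len = proj₁ (++-injective p q (trans e (sym f)) len)

length-∷ʳ : ∀ (t : Word k) x → length (t ++ [ x ]) ≡ suc (length t)
length-∷ʳ t x = trans (length-++ t) (+-comm _ 1)

⊑-∷ʳ-unique : ∀ (t : Word k) {x y} → t ++ [ x ] ⊑ w → t ++ [ y ] ⊑ w → x ≡ y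
⊑-∷ʳ-unique t {x} {y} a b = ∷ʳ-injectiveʳ t t
  (⊑-unique a b (trans (length-∷ʳ t x) (sym (length-∷ʳ t y))))

≢[]⇒length : w ≢ [] → 0 < length w
≢[]⇒length {w = []}    ne = contradiction refl ne
≢[]⇒length {w = _ ∷ _} ne = s≤s z≤n

length⇒≢[] : 0 < length w → w ≢ []
length⇒≢[] () refl

reverse-≢[] : w ≢ [] → reverse w ≢ []
reverse-≢[] {w = w} ne = length⇒≢[] (subst (0 <_) (sym (length-reverse w)) (≢[]⇒length ne))

first-mismatch : ∀ (p q : Word k) →
  p ⊑ q ⊎ q ⊑ p ⊎ (∃ λ t → ∃ λ x → ∃ λ y → x ≢ y × t ++ [ x ] ⊑ p × t ++ [ y ] ⊑ q)
first-mismatch []      q       = inj₁ (q , refl)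
first-mismatch (x ∷ p) []      = inj₂ (inj₁ (x ∷ p , refl))
first-mismatch (x ∷ p) (y ∷ q) with x Fin.≟ y
... | no x≢y = inj₂ (inj₂ ([] , x , y , x≢y , (p , refl) , (q , refl)))
... | yes refl with first-mismatch p q
... | inj₁ (a , refl) = inj₁ (a , refl)
... | inj₂ (inj₁ (a , refl)) = inj₂ (inj₁ (a , refl))
... | inj₂ (inj₂ (t , a , b , a≢b , (_ , refl) , (_ , refl))) =
  inj₂ (inj₂ (x ∷ t , a , b , a≢b , (_ , refl) , (_ , refl)))

-- Powers and periods

^-+ : ∀ (u : Word k) m n → u ^ (m + n) ≡ u ^ m ++ u ^ n
^-+ u zero    n = refl
^-+ u (suc m) n = trans (cong (u ++_) (^-+ u m n)) (sym (++-assoc u _ _))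

^-comm : ∀ (u : Word k) n → u ++ u ^ n ≡ u ^ n ++ u
^-comm u zero    = ++-identityʳ u
^-comm u (suc n) = trans (cong (u ++_) (^-comm u n)) (sym (++-assoc u _ _))

reverse-^ : ∀ (u : Word k) n → reverse (u ^ n) ≡ reverse u ^ n
reverse-^ u zero    = refl
reverse-^ u (suc n) = begin
  reverse (u ++ u ^ n)           ≡⟨ reverse-++ u (u ^ n) ⟩
  reverse (u ^ n) ++ reverse u   ≡⟨ cong (_++ reverse u) (reverse-^ u n) ⟩
  reverse u ^ n ++ reverse u     ≡⟨ ^-comm (reverse u) n ⟨
  reverse u ++ reverse u ^ n     ∎

length-^ : ∀ (u : Word k) n → length (u ^ n) ≡ n * length u
length-^ u zero    = refl
length-^ u (suc n) = trans (length-++ u) (cong (length u +_) (length-^ u n))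

n≤length-^ : ∀ (u : Word k) n → u ≢ [] → n ≤ length (u ^ n)
n≤length-^ u n ne = subst (n ≤_) (sym (length-^ u n))
  (subst (_≤ n * length u) (*-identityʳ n) (*-monoʳ-≤ n (≢[]⇒length ne)))

^-mono-⊑ : ∀ (u : Word k) {m n} → m ≤ n → u ^ m ⊑ u ^ n
^-mono-⊑ u {n = n} z≤n = u ^ n , refl
^-mono-⊑ u (s≤s le) = ++-mono-⊑ u (^-mono-⊑ u le)

⊑ω-downward : p ⊑ w → w ⊑ω u → p ⊑ω u
⊑ω-downward p⊑w (n , w⊑) = n , ⊑-trans p⊑w w⊑

^-⊑ω : ∀ (u : Word k) m → w ⊑ω u → u ^ m ++ w ⊑ω u
^-⊑ω {w = w} u m (n , w⊑) = m + n , subst (u ^ m ++ w ⊑_) (sym (^-+ u m n)) (++-mono-⊑ (u ^ m) w⊑)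

⊑ω-common : p ⊑ω u → q ⊑ω u → ∃ λ w → p ⊑ w × q ⊑ w
⊑ω-common {u = u} (m , p⊑) (n , q⊑) = u ^ (m + n) ,
  ⊑-trans p⊑ (^-mono-⊑ u (m≤m+n m n)) , ⊑-trans q⊑ (^-mono-⊑ u (m≤n+m n m))

⊑ω-comparable : p ⊑ω u → q ⊑ω u → length p ≤ length q → p ⊑ q
⊑ω-comparable a b le with ⊑ω-common a b
... | _ , p⊑ , q⊑ = ⊑-comparable p⊑ q⊑ le

⊑ω-unique : p ⊑ω u → q ⊑ω u → length p ≡ length q → p ≡ q
⊑ω-unique a b len with ⊑ω-common a b
... | _ , p⊑ , q⊑ = ⊑-unique p⊑ q⊑ len

⊑ω-∷ʳ-unique : ∀ (t : Word k) {x y} → t ++ [ x ] ⊑ω u → t ++ [ y ] ⊑ω u → x ≡ y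
⊑ω-∷ʳ-unique t a b with ⊑ω-common a b
... | _ , p⊑ , q⊑ = ⊑-∷ʳ-unique t p⊑ q⊑

⊑ω⇒⊑ : w ⊑ω u → w ⊑ u ++ w
⊑ω⇒⊑ {w = w} {u = u} (n , w⊑) = ⊑ω-comparable (n , w⊑) (suc n , ++-mono-⊑ u w⊑) (length-++-≤ʳ w {u})

⊑⇒⊑^ : ∀ n → w ⊑ u ++ w → w ⊑ u ^ n ++ w
⊑⇒⊑^ zero    h = ⊑-refl
⊑⇒⊑^ {w = w} {u = u} (suc n) h = subst (w ⊑_) (sym (++-assoc u (u ^ n) w))
  (⊑-trans h (++-mono-⊑ u (⊑⇒⊑^ n h)))

-- Iterating the hypothesis makes `w` a prefix of `u ^ n ++ w` for every `n`; at `n = length w` the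
-- power alone is at least as long as `w`.
⊑⇒⊑ω : u ≢ [] → w ⊑ u ++ w → w ⊑ω u
⊑⇒⊑ω {u = u} {w = w} ne h = length w ,
  ⊑-comparable (⊑⇒⊑^ (length w) h) (⊑-++ (u ^ length w) w) (n≤length-^ u (length w) ne)

⊑ω-root : ∀ {u : Word k} → u ⊑ω u
⊑ω-root {u = u} = 1 , [] , refl

-- Deleting the prefix `a` from a word of period `u` leaves a word whose period is the conjugate
-- `g = a⁻¹ua`.
period-shift : ∀ (a : Word k) → a ++ z ⊑ u ++ a ++ z →
  ∃ λ g → u ++ a ≡ a ++ g × length g ≡ length u × z ⊑ g ++ z
period-shift {z = z} {u = u} a h@(e , eq) with ++-split a (u ++ a)
  (trans (sym (++-assoc a z e)) (trans eq (sym (++-assoc u a z)))) (length-++-≤ʳ a {u})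
... | g , ua≡ag , ze≡gz = g , ua≡ag , len , (e , ze≡gz)
  where
  len : length g ≡ length u
  len = +-cancelˡ-≡ (length a) _ _ (begin
    length a + length g   ≡⟨ length-++ a ⟨
    length (a ++ g)       ≡⟨ cong length ua≡ag ⟨
    length (u ++ a)       ≡⟨ length-++ u ⟩
    length u + length a   ≡⟨ +-comm (length u) _ ⟩
    length a + length u   ∎)

-- The overlap `e` determines the period: `r` and the conjugate of `u` from `period-shift` are both
-- its prefix of length `length u`, so they agree and the period of `a ++ e` runs on through `f`.
period-glue : ∀ (a e f : Word k) → length u ≤ length e → length r ≡ length u →
  a ++ e ⊑ u ++ a ++ e → e ++ f ⊑ r ++ e ++ f → a ++ e ++ f ⊑ u ++ a ++ e ++ f
period-glue {u = u} {r = r} a e f u≤e len left right with period-shift {u = u} a left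
... | g , ua≡ag , g≡u , e⊑ge = subst (a ++ e ++ f ⊑_) shape (++-mono-⊑ a right)
  where
  r⊑e : r ⊑ e
  r⊑e = ⊑-comparable (⊑-++ r (e ++ f)) (⊑-trans (⊑-++ e f) right) (subst (_≤ length e) (sym len) u≤e)
  g⊑e : g ⊑ e
  g⊑e = ⊑-comparable (⊑-++ g e) e⊑ge (subst (_≤ length e) (sym g≡u) u≤e)
  shape : a ++ r ++ e ++ f ≡ u ++ a ++ e ++ f
  shape = begin
    a ++ r ++ e ++ f     ≡⟨ cong (λ h → a ++ h ++ e ++ f) (⊑-unique r⊑e g⊑e (trans len (sym g≡u))) ⟩
    a ++ g ++ e ++ f     ≡⟨ ++-assoc a g (e ++ f) ⟨
    (a ++ g) ++ e ++ f   ≡⟨ cong (_++ e ++ f) ua≡ag ⟨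
    (u ++ a) ++ e ++ f   ≡⟨ ++-assoc u a (e ++ f) ⟩
    u ++ a ++ e ++ f     ∎

-- Euclid's algorithm on lengths: the shorter word is a prefix of the longer one, and removing it
-- leaves a commuting pair. The bound `n` on the total length makes the recursion structural.
commuting-powers : ∀ n (u v : Word k) → length u + length v ≤ n → u ++ v ≡ v ++ u →
  ∃ λ r → ∃ λ i → ∃ λ j → u ≡ r ^ i × v ≡ r ^ j
commuting-powers n [] v le eq = v , 0 , 1 , refl , sym (++-identityʳ v)
commuting-powers n u@(_ ∷ _) [] le eq = u , 1 , 0 , sym (++-identityʳ u) , refl
commuting-powers (suc n) u@(_ ∷ _) v@(_ ∷ _) le eq with ≤-total (length u) (length v)
... | inj₁ u≤v with ++-split u v eq u≤v
... | m , v≡um , v≡mu with commuting-powers n u m bound (trans (sym v≡um) v≡mu)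
  where
  bound : length u + length m ≤ n
  bound = ≤-trans (≤-reflexive (trans (sym (length-++ u)) (cong length (sym v≡um))))
                  (≤-trans (m≤n+m _ _) (≤-pred le))
... | r , i , j , u≡ , m≡ = r , i , i + j , u≡ , trans v≡um (trans (cong₂ _++_ u≡ m≡) (sym (^-+ r i j)))
commuting-powers (suc n) u@(_ ∷ u′) v@(_ ∷ v′) le eq | inj₂ v≤u with ++-split v u (sym eq) v≤u
... | m , u≡vm , u≡mv with commuting-powers n m v bound (trans (sym u≡mv) u≡vm)
  where
  bound : length m + length v ≤ n
  bound = ≤-trans (≤-reflexive (trans (sym (length-++ m)) (cong length (sym u≡mv))))
                  (≤-pred (≤-trans (≤-trans (m≤m+n _ _) (≤-reflexive (sym (+-suc (suc (length u′)) (length v′))))) le))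
... | r , i , j , m≡ , v≡ = r , i + j , j , trans u≡mv (trans (cong₂ _++_ m≡ v≡) (sym (^-+ r i j))) , v≡

-- The common root `r` of the two commuting words cannot be shorter than the primitive `w`, and so
-- equals it.
primitive-commute : Primitive w → w ≢ [] → w ++ z ≡ z ++ w → ∃ λ i → z ≡ w ^ i
primitive-commute {w = w} {z = z} prim ne eq with commuting-powers _ w z ≤-refl eq
... | r , zero  , j , w≡ , z≡ = contradiction w≡ ne
... | r , suc i , j , w≡ , z≡ = j , trans z≡ (cong (_^ j) (sym w≡r))
  where
  rest : ∀ h → w ≡ r ++ h → h ≡ []
  rest []      _   = refl
  rest (x ∷ h) w≡′ = contradiction
    (subst (length r <_) (sym (trans (cong length w≡′) (length-++ r))) (m<m+n _ (s≤s z≤n)))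
    (prim r (suc i) w≡)
  w≡r : w ≡ r
  w≡r = trans w≡ (trans (cong (r ++_) (rest (r ^ i) w≡)) (++-identityʳ r))

primitive-noncommute : u ≢ [] → v ≢ [] → Primitive u → Primitive v → u ≢ v → u ++ v ≢ v ++ u
primitive-noncommute {u = u} {v = v} nu nv pu pv u≢v eq
  with primitive-commute pu nu eq | primitive-commute pv nv (sym eq)
... | i , v≡ | j , u≡ = u≢v (proj₁ (++-injective u v eq
  (≤-antisym (≮⇒≥ (pu v j u≡)) (≮⇒≥ (pv u i v≡)))))

-- Longest common prefixes of two periodic words.

record Divergence (u v : Word k) : Set where
  field
    common  : Word k
    letterˡ : Fin k
    letterʳ : Fin k
    differ  : letterˡ ≢ letterʳ
    alongˡ  : common ++ [ letterˡ ] ⊑ω u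
    alongʳ  : common ++ [ letterʳ ] ⊑ω v

  common-⊑ωˡ : common ⊑ω u
  common-⊑ωˡ = ⊑ω-downward (⊑-++ common _) alongˡ

  common-⊑ωʳ : common ⊑ω v
  common-⊑ωʳ = ⊑ω-downward (⊑-++ common _) alongʳ

open Divergence

-- A weak form of the Fine-Wilf theorem. Since `v` begins `w`, `u ++ v` begins `u ++ w`, which also
-- begins with `w`; hence `u ++ v` begins `w`, and by symmetry so does `v ++ u`.
long-common⇒commute : w ⊑ω u → w ⊑ω v → length u + length v ≤ length w → u ++ v ≡ v ++ u
long-common⇒commute {w = w} {u = u} {v = v} wu wv le =
  ⊑-unique (inside wu wv le) (inside wv wu (subst (_≤ length w) (+-comm (length u) _) le)) (length-++-comm u v)
  where
  inside : ∀ {u v} → w ⊑ω u → w ⊑ω v → length u + length v ≤ length w → u ++ v ⊑ w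
  inside {u} {v} wu wv le = ⊑-comparable
    (++-mono-⊑ u (⊑ω-comparable ⊑ω-root wv (≤-trans (m≤n+m _ _) le))) (⊑ω⇒⊑ wu)
    (subst (_≤ length w) (sym (length-++ u)) le)

diverge : u ≢ [] → v ≢ [] → u ++ v ≢ v ++ u → Divergence u v
diverge {u = u} {v = v} nu nv nc with length u + length v in eq
-- The exponent `length u + length v` makes both powers long enough for `long-common⇒commute`, so
-- neither can be a prefix of the other.
... | n with first-mismatch (u ^ n) (v ^ n)
... | inj₁ h = contradiction
  (long-common⇒commute (n , ⊑-refl) (n , h) (subst (_≤ length (u ^ n)) (sym eq) (n≤length-^ u n nu))) nc
... | inj₂ (inj₁ h) = contradiction
  (long-common⇒commute (n , h) (n , ⊑-refl) (subst (_≤ length (v ^ n)) (sym eq) (n≤length-^ v n nv))) nc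
... | inj₂ (inj₂ (t , x , y , x≢y , hx , hy)) = record
  { common = t ; letterˡ = x ; letterʳ = y ; differ = x≢y ; alongˡ = n , hx ; alongʳ = n , hy }

Divergence-sym : Divergence u v → Divergence v u
Divergence-sym d = record
  { common = common d ; letterˡ = letterʳ d ; letterʳ = letterˡ d ; differ = λ e → differ d (sym e)
  ; alongˡ = alongʳ d ; alongʳ = alongˡ d }

-- If both other common prefixes were longer, the word `www…` would continue `common d` by
-- `letterˡ d` and also by `letterʳ d`.
ultrametric : (d : Divergence u v) (e : Divergence u w) (f : Divergence v w) →
  ¬ (length (common d) < length (common e) × length (common d) < length (common f))
ultrametric d e f (lte , ltf) = differ d (⊑ω-∷ʳ-unique (common d)
  (⊑ω-downward (⊑ω-comparable (alongˡ d) (common-⊑ωˡ e) (subst (_≤ _) (sym (length-∷ʳ (common d) _)) lte)) (common-⊑ωʳ e))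
  (⊑ω-downward (⊑ω-comparable (alongʳ d) (common-⊑ωˡ f) (subst (_≤ _) (sym (length-∷ʳ (common d) _)) ltf)) (common-⊑ωʳ f)))

-- Palindromes

reverse-++₃ : ∀ (a b c : Word k) → reverse (a ++ b ++ c) ≡ reverse c ++ reverse b ++ reverse a
reverse-++₃ {k} a b c = begin
  reverse (a ++ b ++ c)                    ≡⟨ reverse-++ a (b ++ c) ⟩
  reverse (b ++ c) ++ reverse a            ≡⟨ cong (_++ reverse a) (reverse-++ b c) ⟩
  (reverse c ++ reverse b) ++ reverse a    ≡⟨ ++-assoc (reverse c) _ _ ⟩
  reverse c ++ reverse b ++ reverse a      ∎

Pal-mirror : ∀ (p z : Word k) → Pal p → Pal (p ++ z) → p ++ z ≡ reverse z ++ p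
Pal-mirror p z pp pz = trans (sym pz) (trans (reverse-++ p z) (cong (reverse z ++_) pp))

-- Reversal turns the suffix `p` of a palindrome into a prefix of the same length, where `p` itself
-- stands as well.
Pal-border : ∀ (z : Word k) → Pal (z ++ p) → p ⊑ z ++ p → Pal p
Pal-border {p = p} z pal h = ⊑-unique
  (reverse z , trans (sym (reverse-++ z p)) pal) h (length-reverse p)

Pal-middle : ∀ (a b c : Word k) → length a ≡ length c → Pal (a ++ b ++ c) → Pal b
Pal-middle a b c len pal = proj₁ (++-injective (reverse b) b
  (proj₂ (++-injective (reverse c) a (trans (sym (reverse-++₃ a b c)) pal) (trans (length-reverse c) (sym len))))
  (length-reverse b))

Pal-reverse : Pal w → Pal (reverse w)
Pal-reverse = cong reverse

Pal-reverse-++ : ∀ (a b : Word k) → Pal (a ++ b) → Pal (reverse b ++ reverse a)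
Pal-reverse-++ a b pal = subst Pal (reverse-++ a b) (Pal-reverse pal)

Pal-reverse-++₃ : ∀ (a b c : Word k) → Pal (a ++ b ++ c) → Pal (reverse c ++ reverse b ++ reverse a)
Pal-reverse-++₃ a b c pal = subst Pal (reverse-++₃ a b c) (Pal-reverse pal)

-- The shorter word is a border of the longer one: a prefix since `t` continues the period `w` to
-- the right, a suffix since `s` continues it to the left.
Pal-descend : ∀ (s t w : Word k) m → t ⊑ w ++ t → reverse s ⊑ reverse w ++ reverse s →
  Pal (s ++ w ^ suc m ++ t) → Pal (s ++ w ^ m ++ t)
Pal-descend {k} s t w m t⊑ (d , seq) pal = Pal-border (reverse d) (subst Pal (sym asSuffix) pal)
  (subst (s ++ w ^ m ++ t ⊑_) (sym asSuffix) asPrefix)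
  where
  sw≡ : reverse d ++ s ≡ s ++ w
  sw≡ = begin
    reverse d ++ s                             ≡⟨ cong (reverse d ++_) (reverse-involutive s) ⟨
    reverse d ++ reverse (reverse s)           ≡⟨ reverse-++ (reverse s) d ⟨
    reverse (reverse s ++ d)                   ≡⟨ cong reverse seq ⟩
    reverse (reverse w ++ reverse s)           ≡⟨ cong reverse (reverse-++ s w) ⟨
    reverse (reverse (s ++ w))                 ≡⟨ reverse-involutive (s ++ w) ⟩
    s ++ w                                     ∎
  asSuffix : reverse d ++ s ++ w ^ m ++ t ≡ s ++ w ^ suc m ++ t
  asSuffix = begin
    reverse d ++ s ++ w ^ m ++ t     ≡⟨ ++-assoc (reverse d) s _ ⟨
    (reverse d ++ s) ++ w ^ m ++ t   ≡⟨ cong (_++ w ^ m ++ t) sw≡ ⟩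
    (s ++ w) ++ w ^ m ++ t           ≡⟨ solve (++-monoid (Fin k)) ⟩
    s ++ (w ++ w ^ m) ++ t           ∎
  asPrefix : s ++ w ^ m ++ t ⊑ s ++ w ^ suc m ++ t
  asPrefix = subst (λ h → s ++ w ^ m ++ t ⊑ s ++ h)
    (trans (sym (++-assoc (w ^ m) w t)) (cong (_++ t) (sym (^-comm w m))))
    (++-mono-⊑ s (++-mono-⊑ (w ^ m) t⊑))

Pal-descend-to : ∀ (s t w : Word k) m d → t ⊑ w ++ t → reverse s ⊑ reverse w ++ reverse s →
  Pal (s ++ w ^ (d + m) ++ t) → Pal (s ++ w ^ m ++ t)
Pal-descend-to s t w m zero    t⊑ s⊑ pal = pal
Pal-descend-to s t w m (suc d) t⊑ s⊑ pal = Pal-descend-to s t w m d t⊑ s⊑ (Pal-descend s t w (d + m) t⊑ s⊑ pal)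

-- The overhang `d` of `w ++ t` over `t` reflects to `e = reverse d` with `s ++ w ≡ e ++ s`. If `w`
-- is at least as long as `s ++ t`, it begins with `t` and ends with `s`, and `q` is the middle of
-- the palindrome `(s ++ t) ++ q ++ (s ++ t)`; otherwise the part `π` of `s ++ t` after `e` is a
-- border of it.
classP-image : ∀ (s t : Word k) → Pal (s ++ t) → w ≢ [] → Pal (s ++ w ++ t) → t ⊑ w ++ t →
  (∃ λ q → Pal q × w ≡ t ++ q ++ s) ⊎
  (s ++ t ≢ [] × ∃ λ r → ∃ λ π → Pal π × length π < length (s ++ t) × s ++ t ≡ r ++ π × s ++ w ≡ r ++ s)
classP-image {k} {w = w} s t pal ne palw (d , td≡wt) = split
  where
  e : Word k
  e = reverse d
  swt≡ : s ++ w ++ t ≡ (s ++ t) ++ d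
  swt≡ = trans (cong (s ++_) (sym td≡wt)) (sym (++-assoc s t d))
  mirrored : (s ++ t) ++ d ≡ e ++ s ++ t
  mirrored = Pal-mirror (s ++ t) d pal (subst Pal swt≡ palw)
  sw≡es : s ++ w ≡ e ++ s
  sw≡es = ++-cancelʳ t _ _ (begin
    (s ++ w) ++ t   ≡⟨ ++-assoc s w t ⟩
    s ++ w ++ t     ≡⟨ trans swt≡ mirrored ⟩
    e ++ s ++ t     ≡⟨ ++-assoc e s t ⟨
    (e ++ s) ++ t   ∎)
  |e|≡|w| : length e ≡ length w
  |e|≡|w| = +-cancelʳ-≡ (length s) _ _ (begin
    length e + length s   ≡⟨ length-++ e ⟨
    length (e ++ s)       ≡⟨ cong length sw≡es ⟨
    length (s ++ w)       ≡⟨ length-++-comm s w ⟩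
    length (w ++ s)       ≡⟨ length-++ w ⟩
    length w + length s   ∎)
  split : _
  split with length (s ++ t) ≤? length w
  ... | yes p≤w with ++-split t w td≡wt (≤-trans (length-++-≤ʳ t {s}) p≤w)
  ... | q₀ , w≡tq₀ , _ with ++-splitʳ e (s ++ t) {s} {q₀} es≡ s≤q₀
    where
    es≡ : e ++ s ≡ (s ++ t) ++ q₀
    es≡ = trans (sym sw≡es) (trans (cong (s ++_) w≡tq₀) (sym (++-assoc s t q₀)))
    s≤q₀ : length s ≤ length q₀
    s≤q₀ = +-cancelˡ-≤ (length t) _ _ (subst₂ _≤_
      (trans (length-++-comm s t) (length-++ t)) (trans (cong length w≡tq₀) (length-++ t)) p≤w)
  ... | q , q₀≡qs , _ = inj₁ (q , Pal-middle (s ++ t) q (s ++ t) refl (subst Pal shape palw) , w≡)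
    where
    w≡ : w ≡ t ++ q ++ s
    w≡ = trans w≡tq₀ (cong (t ++_) q₀≡qs)
    shape : s ++ w ++ t ≡ (s ++ t) ++ q ++ s ++ t
    shape = begin
      s ++ w ++ t                  ≡⟨ cong (λ h → s ++ h ++ t) w≡ ⟩
      s ++ (t ++ q ++ s) ++ t      ≡⟨ solve (++-monoid (Fin k)) ⟩
      (s ++ t) ++ q ++ s ++ t      ∎
  split | no p≰w with ++-split e (s ++ t) (sym mirrored) (subst (_≤ length (s ++ t)) (sym |e|≡|w|) (≰⇒≥ p≰w))
  ... | π , p≡eπ , p≡πd = inj₂ (length⇒≢[] (<-≤-trans (≢[]⇒length ne) (≰⇒≥ p≰w)) , e , π ,
    Pal-border e (subst Pal p≡eπ pal) (d , trans (sym p≡πd) p≡eπ) ,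
    subst (length π <_) (sym (trans (cong length p≡eπ) (length-++ e)))
      (m<n+m _ (subst (0 <_) (sym |e|≡|w|) (≢[]⇒length ne))) ,
    p≡eπ , sw≡es)

classP : (φ : Morphism k) → NonErasing φ → ∀ s t → Pal (s ++ t) →
  (∀ x → Pal (s ++ φ x ++ t) × t ⊑ φ x ++ t) → ClassP φ
classP φ ne s t pal h = s ++ t , s , t , pal , refl ,
  λ x → classP-image s t pal (ne x) (proj₁ (h x)) (proj₂ (h x))

-- The axes of the periodic word …www… given by (s , t) and (s , t′) differ by a multiple of the period.
axis-shift : ∀ (s t w : Word k) → Pal (s ++ t) → Pal (s ++ w ++ t) →
  ∀ {t′} → Pal (s ++ t′) → Pal (s ++ w ++ t′) → t ⊑ t′ → ∃ λ z → t′ ≡ z ++ t × w ++ z ≡ z ++ w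
axis-shift {k} s t w pal palw pal′ palw′ (d , refl) = split
  where
  e : Word k
  e = reverse d
  mirror : ∀ a → Pal (a ++ t) → Pal (a ++ t ++ d) → a ++ t ++ d ≡ (e ++ a) ++ t
  mirror a p p′ = begin
    a ++ t ++ d     ≡⟨ ++-assoc a t d ⟨
    (a ++ t) ++ d   ≡⟨ Pal-mirror (a ++ t) d p (subst Pal (sym (++-assoc a t d)) p′) ⟩
    e ++ a ++ t     ≡⟨ ++-assoc e a t ⟨
    (e ++ a) ++ t   ∎
  split : ∃ λ z → t ++ d ≡ z ++ t × w ++ z ≡ z ++ w
  -- `mirror` at `a = s` yields `z` with `e ++ s ≡ s ++ z`; at `a = s ++ w` the same `e` appears,
  -- and comparing the two cancels to `w ++ z ≡ z ++ w`.
  split with ++-splitʳ (e ++ s) s (sym (mirror s pal pal′)) (length-++-≤ˡ t)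
  ... | z , td≡zt , es≡sz = z , td≡zt , ++-cancelˡ s _ _ (++-cancelʳ t _ _ (begin
    (s ++ w ++ z) ++ t     ≡⟨ solve (++-monoid (Fin k)) ⟩
    (s ++ w) ++ z ++ t     ≡⟨ cong ((s ++ w) ++_) td≡zt ⟨
    (s ++ w) ++ t ++ d     ≡⟨ mirror (s ++ w)
      (subst Pal (sym (++-assoc s w t)) palw) (subst Pal (sym (++-assoc s w _)) palw′) ⟩
    (e ++ s ++ w) ++ t     ≡⟨ cong (_++ t) (++-assoc e s w) ⟨
    ((e ++ s) ++ w) ++ t   ≡⟨ cong (λ h → (h ++ w) ++ t) es≡sz ⟩
    ((s ++ z) ++ w) ++ t   ≡⟨ cong (_++ t) (++-assoc s z w) ⟩
    (s ++ z ++ w) ++ t     ∎))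

-- Palindromicity of s ++ g ++ t says that g is fixed by an anti-automorphism of the free group;
-- fixing x, y, xw and wy forces yx to commute with w. The case split avoids inverses:
-- one of s and reverse t is a prefix of the other.
fixed⇒commute : ∀ (s t x y w : Word k) → Pal (s ++ t) → Pal (s ++ x ++ t) → Pal (s ++ y ++ t) →
  Pal (s ++ (x ++ w) ++ t) → Pal (s ++ (w ++ y) ++ t) → w ++ y ++ x ≡ (y ++ x) ++ w
fixed⇒commute {k} s t x y w pst px py pxw pwy = split
  where
  S = reverse s
  T = reverse t
  ts≡ : T ++ S ≡ s ++ t
  ts≡ = trans (sym (reverse-++ s t)) pst
  flip : ∀ g → Pal (s ++ g ++ t) → T ++ reverse g ++ S ≡ s ++ g ++ t
  flip g pal = trans (sym (reverse-++₃ s g t)) pal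
  R : Word k → Word k
  R = reverse
  split : w ++ y ++ x ≡ (y ++ x) ++ w
  split with ≤-total (length s) (length T)
  ... | inj₁ s≤T with ++-split s T (sym ts≡) s≤T
  ... | c , T≡sc , t≡cS = sym (++-cancelʳ c _ _ (begin
    ((y ++ x) ++ w) ++ c      ≡⟨ solve (++-monoid (Fin k)) ⟩
    y ++ (x ++ w) ++ c        ≡⟨ cong (y ++_) (conj (x ++ w) pxw) ⟨
    y ++ c ++ R (x ++ w)      ≡⟨ cong (λ h → y ++ c ++ h) (reverse-++ x w) ⟩
    y ++ c ++ R w ++ R x      ≡⟨ ++-assoc y c _ ⟨
    (y ++ c) ++ R w ++ R x    ≡⟨ cong (_++ R w ++ R x) (conj y py) ⟨
    (c ++ R y) ++ R w ++ R x  ≡⟨ solve (++-monoid (Fin k)) ⟩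
    (c ++ R y ++ R w) ++ R x  ≡⟨ cong (λ h → (c ++ h) ++ R x) (reverse-++ w y) ⟨
    (c ++ R (w ++ y)) ++ R x  ≡⟨ cong (_++ R x) (conj (w ++ y) pwy) ⟩
    ((w ++ y) ++ c) ++ R x    ≡⟨ ++-assoc (w ++ y) c (R x) ⟩
    (w ++ y) ++ c ++ R x      ≡⟨ cong ((w ++ y) ++_) (conj x px) ⟩
    (w ++ y) ++ x ++ c        ≡⟨ solve (++-monoid (Fin k)) ⟩
    (w ++ y ++ x) ++ c        ∎))
    where
    -- In the free group this reads `g = c (R g) c⁻¹`: the anti-automorphism is reversal followed by
    -- conjugation. In the other case the conjugation is by the inverse of its `c`.
    conj : ∀ g → Pal (s ++ g ++ t) → c ++ R g ≡ g ++ c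
    conj g pal = ++-cancelʳ S _ _ (++-cancelˡ s _ _ (begin
      s ++ (c ++ R g) ++ S     ≡⟨ solve (++-monoid (Fin k)) ⟩
      (s ++ c) ++ R g ++ S     ≡⟨ cong (_++ R g ++ S) T≡sc ⟨
      T ++ R g ++ S            ≡⟨ flip g pal ⟩
      s ++ g ++ t              ≡⟨ cong (λ h → s ++ g ++ h) t≡cS ⟩
      s ++ g ++ c ++ S         ≡⟨ cong (s ++_) (++-assoc g c S) ⟨
      s ++ (g ++ c) ++ S       ∎))
  split | inj₂ T≤s with ++-split T s ts≡ T≤s
  ... | c , s≡Tc , S≡ct = sym (++-cancelˡ c _ _ (begin
    c ++ (y ++ x) ++ w       ≡⟨ solve (++-monoid (Fin k)) ⟩
    (c ++ y) ++ x ++ w       ≡⟨ cong (_++ x ++ w) (conj y py) ⟨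
    (R y ++ c) ++ x ++ w     ≡⟨ ++-assoc (R y) c _ ⟩
    R y ++ c ++ x ++ w       ≡⟨ cong (R y ++_) (conj (x ++ w) pxw) ⟨
    R y ++ R (x ++ w) ++ c   ≡⟨ cong (λ h → R y ++ h ++ c) (reverse-++ x w) ⟩
    R y ++ (R w ++ R x) ++ c ≡⟨ solve (++-monoid (Fin k)) ⟩
    (R y ++ R w) ++ R x ++ c ≡⟨ cong (_++ R x ++ c) (reverse-++ w y) ⟨
    R (w ++ y) ++ R x ++ c   ≡⟨ cong (R (w ++ y) ++_) (conj x px) ⟩
    R (w ++ y) ++ c ++ x     ≡⟨ ++-assoc (R (w ++ y)) c x ⟨
    (R (w ++ y) ++ c) ++ x   ≡⟨ cong (_++ x) (conj (w ++ y) pwy) ⟩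
    (c ++ w ++ y) ++ x       ≡⟨ solve (++-monoid (Fin k)) ⟩
    c ++ w ++ y ++ x         ∎))
    where
    conj : ∀ g → Pal (s ++ g ++ t) → R g ++ c ≡ c ++ g
    conj g pal = ++-cancelʳ t _ _ (++-cancelˡ T _ _ (begin
      T ++ (R g ++ c) ++ t     ≡⟨ cong (T ++_) (++-assoc (R g) c t) ⟩
      T ++ R g ++ c ++ t       ≡⟨ cong (λ h → T ++ R g ++ h) S≡ct ⟨
      T ++ R g ++ S            ≡⟨ flip g pal ⟩
      s ++ g ++ t              ≡⟨ cong (_++ g ++ t) s≡Tc ⟩
      (T ++ c) ++ g ++ t       ≡⟨ solve (++-monoid (Fin k)) ⟩
      T ++ (c ++ g) ++ t       ∎))

-- Rich words

_isFactorOf_ : Word k → Word k → Set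
u isFactorOf w = ∃ λ z → ∃ λ r → z ++ u ++ r ≡ w

∈-factors⁻ : ∀ w → u ∈ factors {k} w → u isFactorOf w
∈-factors⁻ [] (here refl) = [] , [] , refl
∈-factors⁻ (a ∷ w) u∈ with ∈-++⁻ (map (λ n → take n (a ∷ w)) (upTo (suc (length (a ∷ w))))) u∈
... | inj₂ u∈w with ∈-factors⁻ w u∈w
... | z , r , refl = a ∷ z , r , refl
∈-factors⁻ (a ∷ w) u∈ | inj₁ u∈pre with ∈-map⁻ (λ n → take n (a ∷ w)) {xs = upTo (suc (length (a ∷ w)))} u∈pre
... | n , _ , refl = [] , drop n (a ∷ w) , take++drop≡id n (a ∷ w)

take-length-++ : ∀ (p r : Word k) → take (length p) (p ++ r) ≡ p
take-length-++ []      r = refl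
take-length-++ (x ∷ p) r = cong (x ∷_) (take-length-++ p r)

∈-factors⁺ : u isFactorOf w → u ∈ factors w
∈-factors⁺ {u = []} {w = []} ([] , [] , eq) = here refl
∈-factors⁺ {u = u} {w = a ∷ w} ([] , r , eq) = ∈-++⁺ˡ (subst (_∈ prefixes) takeᵤ
  (∈-map⁺ (λ n → take n (a ∷ w)) (∈-upTo⁺ (s≤s (⊑⇒≤ (r , eq))))))
  where
  prefixes = map (λ n → take n (a ∷ w)) (upTo (suc (length (a ∷ w))))
  takeᵤ : take (length u) (a ∷ w) ≡ u
  takeᵤ = trans (cong (take (length u)) (sym eq)) (take-length-++ u r)
∈-factors⁺ {w = a ∷ w} (c ∷ z , r , eq) = ∈-++⁺ʳ _ (∈-factors⁺ (z , r , ∷-injectiveʳ eq))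

∈-palFactors⁻ : ∀ w → u ∈ palFactors {k} w → Pal u × u isFactorOf w
∈-palFactors⁻ w u∈ with ∈-filter⁻ (λ u → reverse u ≟W u) {xs = factors w} (∈-deduplicate⁻ _≟W_ _ u∈)
... | u∈f , pal = pal , ∈-factors⁻ w u∈f

∈-palFactors⁺ : Pal u → u isFactorOf w → u ∈ palFactors w
∈-palFactors⁺ pal fac = ∈-deduplicate⁺ _≟W_ (∈-filter⁺ (λ u → reverse u ≟W u) (∈-factors⁺ fac) pal)

palFactors-unique : ∀ (w : Word k) → Unique (palFactors w)
palFactors-unique w = deduplicate-! _
  where open import Data.List.Relation.Unary.Unique.DecPropositional.Properties _≟W_ using (deduplicate-!)

module _ {A : Set} where

  Unique-⊆⇒length≤ : ∀ {xs ys : List A} → Unique xs → (∀ {x} → x ∈ xs → x ∈ ys) → length xs ≤ length ys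
  Unique-⊆⇒length≤ [] _ = z≤n
  Unique-⊆⇒length≤ {x ∷ xs} {ys} (x∉xs ∷ uniq) xs⊆ys with ∈-∃++ (xs⊆ys (here refl))
  ... | ls , rs , refl = subst (suc (length xs) ≤_) (sym (length-++-sucʳ ls x rs))
    (s≤s (Unique-⊆⇒length≤ uniq remove))
    where
    remove : ∀ {y} → y ∈ xs → y ∈ ls ++ rs
    remove y∈ with ∈-++⁻ ls (xs⊆ys (there y∈))
    ... | inj₁ y∈ls = ∈-++⁺ˡ y∈ls
    ... | inj₂ (there y∈rs) = ∈-++⁺ʳ ls y∈rs
    ... | inj₂ (here refl) = contradiction refl (All.lookup x∉xs y∈)

⊑⇒factor : p ⊑ w → p isFactorOf w
⊑⇒factor (r , eq) = [] , r , eq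

factor-∷⁺ : ∀ {a} → u isFactorOf w → u isFactorOf (a ∷ w)
factor-∷⁺ (z , r , eq) = _ ∷ z , r , cong (_ ∷_) eq

factor-∷⁻ : ∀ {a} → u isFactorOf (a ∷ w) → ¬ u isFactorOf w → u ⊑ a ∷ w
factor-∷⁻ ([]    , r , eq) _  = r , eq
factor-∷⁻ (_ ∷ z , r , eq) ∉w = contradiction (z , r , ∷-injectiveʳ eq) ∉w

-- A witness that prepending `a` to `w` adds a palindromic factor. A letter adds at most one, so a
-- word is rich when, built from its last letter, it gains one at every letter.
record NewPalindrome (a : Fin k) (w : Word k) : Set where
  field
    word   : Word k
    isPal  : Pal word
    prefix : word ⊑ a ∷ w
    fresh  : ¬ word isFactorOf w

open NewPalindrome

-- The palindrome `q` ends as well as begins with `p`, and as `p` is shorter its occurrence at the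
-- end starts after the letter `a`.
shorter-recurs : ∀ {a} → Pal p → Pal q → p ⊑ a ∷ w → q ⊑ a ∷ w → length p < length q → p isFactorOf w
shorter-recurs {p = p} {q = q} {w = w} {a = a} palp palq p⊑ q⊑ lt with ⊑-comparable p⊑ q⊑ (<⇒≤ lt)
... | d , refl with reverse d | Pal-mirror p d palp palq
... | []    | eq = contradiction (cong length eq) (>⇒≢ lt)
... | _ ∷ e | eq = e , proj₁ q⊑ , trans (sym (++-assoc e p (proj₁ q⊑)))
  (∷-injectiveʳ (trans (cong (_++ proj₁ q⊑) (sym eq)) (proj₂ q⊑)))

new-unique : ∀ {a} (m n : NewPalindrome {k} a w) → word m ≡ word n
new-unique m n with <-cmp (length (word m)) (length (word n))
... | tri< lt _ _ = contradiction (shorter-recurs (isPal m) (isPal n) (prefix m) (prefix n) lt) (fresh m)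
... | tri≈ _ eq _ = ⊑-unique (prefix m) (prefix n) eq
... | tri> _ _ gt = contradiction (shorter-recurs (isPal n) (isPal m) (prefix n) (prefix m) gt) (fresh n)

new⁺ : ∀ a (w : Word k) → u ∈ palFactors (a ∷ w) → u ∉ palFactors w → NewPalindrome a w
new⁺ {u = u} a w u∈ u∉ with ∈-palFactors⁻ (a ∷ w) u∈
... | palu , fac = record
  { word = u ; isPal = palu ; prefix = factor-∷⁻ fac ∉w ; fresh = ∉w }
  where
  ∉w : ¬ u isFactorOf w
  ∉w f = u∉ (∈-palFactors⁺ palu f)

module _ {k : ℕ} where
  open import Data.List.Membership.DecPropositional (_≟W_ {k}) public using (_∈?_)

new? : ∀ a (w : Word k) → (length (palFactors (a ∷ w)) ≤ length (palFactors w)) ⊎ NewPalindrome a w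
new? a w with All.all? (_∈? palFactors w) (palFactors (a ∷ w))
... | yes all = inj₁ (Unique-⊆⇒length≤ (palFactors-unique (a ∷ w)) (All.lookup all))
... | no ¬all with find (¬All⇒Any¬ (_∈? palFactors w) _ ¬all)
... | u , u∈ , u∉ = inj₂ (new⁺ a w u∈ u∉)

palFactors-∷-≤ : ∀ a (w : Word k) → length (palFactors (a ∷ w)) ≤ suc (length (palFactors w))
palFactors-∷-≤ a w with new? a w
... | inj₁ le = m≤n⇒m≤1+n le
... | inj₂ new = Unique-⊆⇒length≤ (palFactors-unique (a ∷ w)) incl
  where
  incl : ∀ {u} → u ∈ palFactors (a ∷ w) → u ∈ word new ∷ palFactors w
  incl {u} u∈ with u ∈? palFactors w
  ... | yes u∈w = there u∈w
  ... | no u∉w = here (new-unique (new⁺ a w u∈ u∉w) new)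

palFactors-≤ : ∀ (w : Word k) → length (palFactors w) ≤ suc (length w)
palFactors-≤ []      = ≤-refl
palFactors-≤ (a ∷ w) = ≤-trans (palFactors-∷-≤ a w) (s≤s (palFactors-≤ w))

rich⇒new : ∀ a (w : Word k) → Rich (a ∷ w) → NewPalindrome a w
rich⇒new a w rich with new? a w
... | inj₁ le  = contradiction (≤-trans le (palFactors-≤ w)) (<⇒≱ (≤-reflexive (sym rich)))
... | inj₂ new = new

new⇒rich : ∀ {a} {w : Word k} → Rich w → NewPalindrome a w → Rich (a ∷ w)
new⇒rich {a = a} {w = w} rich new = ≤-antisym (palFactors-≤ (a ∷ w))
  (subst (_≤ length (palFactors (a ∷ w))) (cong suc rich) (Unique-⊆⇒length≤ uniq incl))
  where
  uniq : Unique (word new ∷ palFactors w)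
  uniq = All.tabulate (λ {u} u∈ e → fresh new (subst (_isFactorOf w) (sym e) (proj₂ (∈-palFactors⁻ w u∈))))
    ∷ palFactors-unique w
  incl : ∀ {u} → u ∈ word new ∷ palFactors w → u ∈ palFactors (a ∷ w)
  incl (here refl) = ∈-palFactors⁺ (isPal new) (⊑⇒factor (prefix new))
  incl (there u∈) with ∈-palFactors⁻ w u∈
  ... | palu , fac = ∈-palFactors⁺ palu (factor-∷⁺ {a = a} fac)

-- Richness of the words aᵐbⁿaᵐ⁺ᵈ with n positive.

module _ {a b : Fin k} (a≢b : a ≢ b) where

  private
    A B : ℕ → Word k
    A n = replicate n a
    B n = replicate n b

  letter∉ : ∀ n (z r : Word k) → z ++ b ∷ r ≢ A n
  letter∉ (suc n) []      r eq = a≢b (sym (∷-injectiveˡ eq))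
  letter∉ (suc n) (_ ∷ z) r eq = letter∉ n z r (∷-injectiveʳ eq)

  run-too-long : ∀ {i j} l (z r : Word k) → j < i → z ++ B i ++ r ≢ B j ++ A l
  run-too-long {suc i} {zero}  l z r lt eq = letter∉ l z (B i ++ r) eq
  run-too-long {suc i} {suc j} l []      r (s≤s lt) eq = run-too-long l [] r lt (∷-injectiveʳ eq)
  run-too-long {suc i} {suc j} l (_ ∷ z) r (s≤s lt) eq =
    run-too-long l z r (m≤n⇒m≤1+n lt) (∷-injectiveʳ eq)

  no-ab : ∀ j l (z r : Word k) → z ++ a ∷ b ∷ r ≢ B j ++ A l
  no-ab zero    (suc l) []      r eq = letter∉ l [] r (∷-injectiveʳ eq)
  no-ab zero    (suc l) (_ ∷ z) r eq = no-ab zero l z r (∷-injectiveʳ eq)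
  no-ab (suc j) l       []      r eq = a≢b (∷-injectiveˡ eq)
  no-ab (suc j) l       (_ ∷ z) r eq = no-ab j l z r (∷-injectiveʳ eq)

  -- In `A j ++ B m ++ A l` the letter `b` can follow `a` only at the end of the first block, which
  -- has fewer than `i` letters.
  block-too-long : ∀ {i j} m l (z r : Word k) → j < i → z ++ A i ++ b ∷ r ≢ A j ++ B m ++ A l
  block-too-long {suc zero} {zero} m l z r lt eq = no-ab m l z r eq
  block-too-long {suc (suc i)} {zero} m l z r lt eq = no-ab m l (z ++ A (suc i)) r
    (trans (trans (++-assoc z _ _) (cong (λ h → z ++ a ∷ h) (snoc i))) eq)
    where
    snoc : ∀ i → A i ++ a ∷ b ∷ r ≡ a ∷ A i ++ b ∷ r
    snoc zero    = refl
    snoc (suc i) = cong (a ∷_) (snoc i)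
  block-too-long {suc i} {suc j} m l []      r (s≤s lt) eq = block-too-long m l [] r lt (∷-injectiveʳ eq)
  block-too-long {suc i} {suc j} m l (_ ∷ z) r (s≤s lt) eq =
    block-too-long m l z r (m≤n⇒m≤1+n lt) (∷-injectiveʳ eq)

reverse-replicate : ∀ n (a : Fin k) → reverse (replicate n a) ≡ replicate n a
reverse-replicate zero    a = refl
reverse-replicate (suc n) a = begin
  reverse (a ∷ replicate n a)        ≡⟨ unfold-reverse a (replicate n a) ⟩
  reverse (replicate n a) ++ [ a ]   ≡⟨ cong (_++ [ a ]) (reverse-replicate n a) ⟩
  replicate n a ++ [ a ]             ≡⟨ snoc n ⟩
  a ∷ replicate n a                  ∎
  where
  snoc : ∀ n → replicate n a ++ [ a ] ≡ a ∷ replicate n a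
  snoc zero    = refl
  snoc (suc n) = cong (a ∷_) (snoc n)

replicate-+ : ∀ m n (a : Fin k) → replicate (m + n) a ≡ replicate m a ++ replicate n a
replicate-+ zero    n a = refl
replicate-+ (suc m) n a = cong (a ∷_) (replicate-+ m n a)

-- The word is built from its last letter to its first, and each letter contributes one palindrome:
-- first powers of `a`, then powers of `b`, then aⁱbⁿ⁺¹aⁱ. The last kind fits because the final
-- block is no shorter than the first.
rich-aba : ∀ {a b : Fin k} → a ≢ b → ∀ m n d → Rich (replicate m a ++ replicate (suc n) b ++ replicate (m + d) a)
rich-aba {k} {a} {b} a≢b m n d = left m ≤-refl
  where
  l = m + d
  base : ∀ l → Rich (replicate l a)
  base zero    = refl
  base (suc l) = new⇒rich (base l) record
    { word = replicate (suc l) a ; isPal = reverse-replicate (suc l) a ; prefix = ⊑-refl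
    -- Here `run-too-long` is used with the two letters exchanged and an empty second block.
    ; fresh = λ (z , r , eq) → run-too-long (λ e → a≢b (sym e)) 0 z r ≤-refl (trans eq (sym (++-identityʳ _))) }
  middle : ∀ n → Rich (replicate n b ++ replicate l a)
  middle zero    = base l
  middle (suc n) = new⇒rich (middle n) record
    { word = replicate (suc n) b ; isPal = reverse-replicate (suc n) b ; prefix = ⊑-++ _ _
    ; fresh = λ (z , r , eq) → run-too-long a≢b l z r ≤-refl eq }
  left : ∀ i → i ≤ m → Rich (replicate i a ++ replicate (suc n) b ++ replicate l a)
  left zero    _  = middle (suc n)
  left (suc i) le = new⇒rich (left i (<⇒≤ le)) record
    { word   = x ++ y ++ x
    ; isPal  = trans (reverse-++₃ x y x) (cong₂ _++_ rx (cong₂ _++_ (reverse-replicate (suc n) b) rx))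
    ; prefix = ++-mono-⊑ x (++-mono-⊑ y (replicate (m + d ∸ suc i) a ,
        trans (sym (replicate-+ (suc i) _ a)) (cong (λ h → replicate h a) (m+[n∸m]≡n (≤-trans le (m≤m+n m d))))))
    ; fresh  = λ (z , r , eq) → block-too-long a≢b (suc n) l z ((replicate n b ++ x) ++ r) ≤-refl
        (trans (cong (z ++_) (sym (++-assoc x (y ++ x) r))) eq) }
    where
    x = replicate (suc i) a
    y = replicate (suc n) b
    rx : reverse x ≡ x
    rx = reverse-replicate (suc i) a

-- The unioccurrent palindromic prefix and its centre.

rich⇒unioccurrent : w ≢ [] → Rich w →
  ∃ λ p → Pal p × p ⊑ w × (∀ z r → z ++ p ++ r ≡ w → z ≡ [])
rich⇒unioccurrent {w = []}    ne rich = contradiction refl ne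
rich⇒unioccurrent {w = a ∷ w} ne rich = word new , isPal new , prefix new , first
  where
  new = rich⇒new a w rich
  first : ∀ z r → z ++ word new ++ r ≡ a ∷ w → z ≡ []
  first []      r eq = refl
  first (_ ∷ z) r eq = contradiction (z , r , ∷-injectiveʳ eq) (fresh new)

++-≢[] : ∀ (q : Word k) → p ≢ [] → p ++ q ≢ []
++-≢[] {p = p} q ne eq = ne (++-conicalˡ p q eq)

-- A palindromic prefix P of uᴹvⁿuᴹ⁺ⁿ without further occurrences must end inside the second
-- block of u's, since otherwise it would be a prefix of uuu…; comparing the u-periodic
-- prefix and suffix of P then shows that P is centred at the centre of s vⁿ t, where s = reverse S.
module Centre {u v : Word k} (u≢[] : u ≢ []) (R : Divergence u v) (L : Divergence (reverse u) (reverse v))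
  {M N : ℕ} (N≤M : N ≤ M) (u⊑uᴺ : u ⊑ u ^ N) (u⊑uᴹ : u ⊑ u ^ M)
  (wide : length (v ^ N ++ u ^ N) + length u ≤ length (u ^ M))
  (tx⊑ : common R ++ [ letterˡ R ] ⊑ u ^ N) (ty⊑ : common R ++ [ letterʳ R ] ⊑ v ^ N)
  (sx⊑ : common L ++ [ letterˡ L ] ⊑ reverse u ^ N) (sy⊑ : common L ++ [ letterʳ L ] ⊑ reverse v ^ N)
  (rich : Rich (u ^ M ++ v ^ N ++ u ^ (M + N))) where

  private
    t = common R
    S = common L
    U = reverse u
    W = u ^ M ++ v ^ N ++ u ^ (M + N)
    G = u ^ M ++ t

    uᴹ≢[] : u ^ M ≢ []
    uᴹ≢[] = length⇒≢[] (<-≤-trans (≢[]⇒length u≢[]) (⊑⇒≤ u⊑uᴹ))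

    t⊑u : t ⊑ u ^ N
    t⊑u = ⊑-trans (⊑-++ t _) tx⊑

    Gy⊑W : G ++ [ letterʳ R ] ⊑ W
    Gy⊑W = subst (_⊑ W) (sym (++-assoc (u ^ M) t _))
      (++-mono-⊑ (u ^ M) (⊑-trans ty⊑ (⊑-++ (v ^ N) _)))

    Gx⊑ω : G ++ [ letterˡ R ] ⊑ω u
    Gx⊑ω = subst (_⊑ω u) (sym (++-assoc (u ^ M) t _)) (^-⊑ω u M (N , tx⊑))

    module _ (P : Word k) (palP : Pal P) (P⊑W : P ⊑ W) (first : ∀ z r → z ++ P ++ r ≡ W → z ≡ []) where

      -- Otherwise `P` would be a prefix of `u ^ (M + N)` and recur at the start of the last block
      -- of `W`, contrary to `first`.
      G<P : length G < length P
      G<P = ≰⇒> λ P≤G → early (⊑-trans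
        (⊑-comparable P⊑W (⊑-trans (⊑-++ G _) Gy⊑W) P≤G) (++-mono-⊑ (u ^ M) t⊑u))
        where
        early : ¬ P ⊑ u ^ M ++ u ^ N
        early (r , eq) = ++-≢[] (v ^ N) uᴹ≢[] (first (u ^ M ++ v ^ N) r (begin
          (u ^ M ++ v ^ N) ++ P ++ r        ≡⟨ ++-assoc (u ^ M) (v ^ N) _ ⟩
          u ^ M ++ v ^ N ++ P ++ r          ≡⟨ cong (λ h → u ^ M ++ v ^ N ++ h) (trans eq (sym (^-+ u M N))) ⟩
          u ^ M ++ v ^ N ++ u ^ (M + N)     ∎))

      Gy⊑P : G ++ [ letterʳ R ] ⊑ P
      Gy⊑P = ⊑-comparable Gy⊑W P⊑W (subst (_≤ length P) (sym (length-∷ʳ G _)) G<P)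

      G⊑P : G ⊑ P
      G⊑P = ⊑-trans (⊑-++ G _) Gy⊑P

      -- If `P` ended this early, `wide` would make its prefix `u ^ M` and its suffix `U ^ M`
      -- overlap in a word `E` at least as long as `u`. Gluing the periods would make all of `P` a
      -- prefix of `uuu…`, whereas `P` leaves that word after `G`.
      not-short : ¬ length P ≤ length (u ^ M ++ v ^ N ++ u ^ N)
      not-short le with ⊑-trans (⊑-++ (u ^ M) t) G⊑P
      ... | P′ , uP′≡P = overrun
        where
        glued : reverse P′ ++ U ^ M ≡ u ^ M ++ P′
        glued = begin
          reverse P′ ++ U ^ M             ≡⟨ cong (reverse P′ ++_) (reverse-^ u M) ⟨
          reverse P′ ++ reverse (u ^ M)   ≡⟨ reverse-++ (u ^ M) P′ ⟨
          reverse (u ^ M ++ P′)           ≡⟨ cong reverse uP′≡P ⟩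
          reverse P                       ≡⟨ palP ⟩
          P                               ≡⟨ uP′≡P ⟨
          u ^ M ++ P′                     ∎
        P′≤ : length P′ ≤ length (v ^ N ++ u ^ N)
        P′≤ = +-cancelˡ-≤ (length (u ^ M)) _ _ (subst₂ _≤_
          (trans (cong length (sym uP′≡P)) (length-++ (u ^ M))) (length-++ (u ^ M)) le)
        room : length (reverse P′) + length u ≤ length (u ^ M)
        room = ≤-trans (+-monoˡ-≤ (length u) (subst (_≤ _) (sym (length-reverse P′)) P′≤)) wide
        overrun : ⊥
        overrun with ++-split (reverse P′) (u ^ M) glued (≤-trans (m≤m+n _ (length u)) room)
        ... | E , uM≡ , UM≡ = differ R (⊑ω-∷ʳ-unique G Gx⊑ω (⊑ω-downward Gy⊑P (⊑⇒⊑ω u≢[] periodic)))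
          where
          u≤E : length u ≤ length E
          u≤E = +-cancelˡ-≤ (length (reverse P′)) _ _
            (subst (length (reverse P′) + length u ≤_) (trans (cong length uM≡) (length-++ (reverse P′))) room)
          periodic : P ⊑ u ++ P
          periodic = subst (λ h → h ⊑ u ++ h)
            (trans (sym (++-assoc (reverse P′) E P′)) (trans (cong (_++ P′) (sym uM≡)) uP′≡P))
            (period-glue {u = u} {r = U} (reverse P′) E P′ u≤E (length-reverse u)
              (subst (λ h → h ⊑ u ++ h) uM≡ (⊑ω⇒⊑ (M , ⊑-refl)))
              (subst (λ h → h ⊑ U ++ h) UM≡ (⊑ω⇒⊑ (M , ⊑-refl))))

      module _ (P″ : Word k) (P≡ : u ^ M ++ v ^ N ++ P″ ≡ P) (long : u ^ N ⊑ P″)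
        (β : Word k) (P″β≡ : P″ ++ β ≡ u ^ (M + N)) where

        -- `G` is where `P` leaves `uuu…`, read off from the given factorisation; `H` is the same
        -- place read off from the reversed one.
        H = reverse P″ ++ S

        reversed : reverse P″ ++ reverse v ^ N ++ U ^ M ≡ P
        reversed = begin
          reverse P″ ++ reverse v ^ N ++ U ^ M
            ≡⟨ cong₂ (λ h h′ → reverse P″ ++ h ++ h′) (reverse-^ v N) (reverse-^ u M) ⟨
          reverse P″ ++ reverse (v ^ N) ++ reverse (u ^ M)   ≡⟨ reverse-++₃ (u ^ M) (v ^ N) P″ ⟨
          reverse (u ^ M ++ v ^ N ++ P″)                     ≡⟨ cong reverse P≡ ⟩
          reverse P                                          ≡⟨ palP ⟩
          P                                                  ∎

        Hy⊑P : H ++ [ letterʳ L ] ⊑ P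
        Hy⊑P = subst₂ _⊑_ (sym (++-assoc (reverse P″) S _)) reversed
          (++-mono-⊑ (reverse P″) (⊑-trans sy⊑ (⊑-++ (reverse v ^ N) _)))

        H⊑P : H ⊑ P
        H⊑P = ⊑-trans (⊑-++ H _) Hy⊑P

        u≤H : length u ≤ length H
        u≤H = ≤-trans (≤-trans (⊑⇒≤ (⊑-trans u⊑uᴺ long)) (≤-reflexive (sym (length-reverse P″))))
          (length-++-≤ˡ (reverse P″))

        -- Preceded by `reverse β`, this word begins `UUU…`, so it has a conjugate `g` of `U` as a
        -- period. Both `g` and `u` are prefixes of `P` of the same length, hence equal.
        Hx⊑ω : H ++ [ letterˡ L ] ⊑ω u
        Hx⊑ω = align (period-shift {u = U} (reverse β) (⊑ω⇒⊑ inside))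
          where
          Hx : Word k
          Hx = H ++ [ letterˡ L ]
          inside : reverse β ++ Hx ⊑ω U
          inside = subst (_⊑ω U) shape (^-⊑ω U (M + N) (N , sx⊑))
            where
            Sx : Word k
            Sx = S ++ [ letterˡ L ]
            shape : U ^ (M + N) ++ Sx ≡ reverse β ++ Hx
            shape = begin
              U ^ (M + N) ++ Sx                  ≡⟨ cong (_++ Sx) (reverse-^ u (M + N)) ⟨
              reverse (u ^ (M + N)) ++ Sx        ≡⟨ cong (λ h → reverse h ++ Sx) P″β≡ ⟨
              reverse (P″ ++ β) ++ Sx            ≡⟨ cong (_++ Sx) (reverse-++ P″ β) ⟩
              (reverse β ++ reverse P″) ++ Sx    ≡⟨ ++-assoc (reverse β) (reverse P″) Sx ⟩
              reverse β ++ reverse P″ ++ Sx      ≡⟨ cong (reverse β ++_) (++-assoc (reverse P″) S _) ⟨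
              reverse β ++ Hx                    ∎
          align : (∃ λ g → U ++ reverse β ≡ reverse β ++ g × length g ≡ length U × Hx ⊑ g ++ Hx) → Hx ⊑ω u
          align (g , _ , |g|≡|U| , Hx⊑) = ⊑⇒⊑ω u≢[] (subst (λ h → Hx ⊑ h ++ Hx) g≡u Hx⊑)
            where
            |g|≡|u| : length g ≡ length u
            |g|≡|u| = trans |g|≡|U| (length-reverse u)
            g≡u : g ≡ u
            g≡u = ⊑-unique (⊑-trans (⊑-comparable (⊑-++ g _) (⊑-trans (⊑-++ H _) Hx⊑)
                (subst (_≤ length H) (sym |g|≡|u|) u≤H)) H⊑P)
              (⊑-trans (⊑-trans u⊑uᴹ (⊑-++ (u ^ M) t)) G⊑P) |g|≡|u|

        -- If one were shorter, the other would continue it in `P` by the letter of `uuu…`, while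
        -- `P` has a different letter there.
        G≡H : length G ≡ length H
        G≡H with <-cmp (length G) (length H)
        ... | tri≈ _ eq _ = eq
        ... | tri< lt _ _ = contradiction (⊑-∷ʳ-unique G (⊑-trans (⊑ω-comparable Gx⊑ω
          (⊑ω-downward (⊑-++ H _) Hx⊑ω) (subst (_≤ length H) (sym (length-∷ʳ G _)) lt)) H⊑P) Gy⊑P) (differ R)
        ... | tri> _ _ gt = contradiction (⊑-∷ʳ-unique H (⊑-trans (⊑ω-comparable Hx⊑ω
          (⊑ω-downward (⊑-++ G _) Gx⊑ω) (subst (_≤ length G) (sym (length-∷ʳ H _)) gt)) G⊑P) Hy⊑P) (differ L)

        centred : Pal (reverse S ++ v ^ N ++ t)
        -- By `G≡H` the parts `reverse e` and `P₂` of `P` on the two sides of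
        -- `reverse S ++ v ^ N ++ t` have equal length, so the middle inherits the symmetry.
        centred with ⊑-trans (⊑-trans (⊑-++ S _) sx⊑) (^-mono-⊑ U N≤M) | ⊑-trans t⊑u long
        ... | e , Se≡ | P₂ , tP₂≡ = Pal-middle (reverse e) (reverse S ++ v ^ N ++ t) P₂ len (subst Pal (sym shape) palP)
          where
          uM≡ : reverse e ++ reverse S ≡ u ^ M
          uM≡ = begin
            reverse e ++ reverse S         ≡⟨ reverse-++ S e ⟨
            reverse (S ++ e)               ≡⟨ cong reverse Se≡ ⟩
            reverse (U ^ M)                ≡⟨ cong reverse (reverse-^ u M) ⟨
            reverse (reverse (u ^ M))      ≡⟨ reverse-involutive (u ^ M) ⟩
            u ^ M                          ∎
          shape : reverse e ++ (reverse S ++ v ^ N ++ t) ++ P₂ ≡ P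
          shape = begin
            reverse e ++ (reverse S ++ v ^ N ++ t) ++ P₂     ≡⟨ solve (++-monoid (Fin k)) ⟩
            (reverse e ++ reverse S) ++ v ^ N ++ t ++ P₂     ≡⟨ cong₂ (λ h h′ → h ++ v ^ N ++ h′) uM≡ tP₂≡ ⟩
            u ^ M ++ v ^ N ++ P″                             ≡⟨ P≡ ⟩
            P                                                ∎
          len : length (reverse e) ≡ length P₂
          len = +-cancelʳ-≡ (length S + length t) _ _ (begin
            length (reverse e) + (length S + length t)
              ≡⟨ cong (λ h → length (reverse e) + (h + length t)) (length-reverse S) ⟨
            length (reverse e) + (length (reverse S) + length t)   ≡⟨ +-assoc (length (reverse e)) _ _ ⟨
            (length (reverse e) + length (reverse S)) + length t   ≡⟨ cong (_+ length t) (length-++ (reverse e)) ⟨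
            length (reverse e ++ reverse S) + length t             ≡⟨ cong (λ h → length h + length t) uM≡ ⟩
            length (u ^ M) + length t                              ≡⟨ length-++ (u ^ M) ⟨
            length G                                               ≡⟨ G≡H ⟩
            length (reverse P″ ++ S)                               ≡⟨ length-++ (reverse P″) ⟩
            length (reverse P″) + length S                         ≡⟨ cong (_+ length S) (length-reverse P″) ⟩
            length P″ + length S                                   ≡⟨ cong (λ h → length h + length S) tP₂≡ ⟨
            length (t ++ P₂) + length S                            ≡⟨ cong (_+ length S) (length-++-comm t P₂) ⟩
            length (P₂ ++ t) + length S                            ≡⟨ cong (_+ length S) (length-++ P₂) ⟩
            (length P₂ + length t) + length S                      ≡⟨ +-assoc (length P₂) _ _ ⟩
            length P₂ + (length t + length S)                      ≡⟨ cong (length P₂ +_) (+-comm (length t) _) ⟩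
            length P₂ + (length S + length t)                      ∎)

      centre : Pal (reverse S ++ v ^ N ++ t)
      centre = finish (⊑-comparable {p = u ^ M ++ v ^ N ++ u ^ N}
        (++-mono-⊑ (u ^ M) (++-mono-⊑ (v ^ N) (^-mono-⊑ u (m≤n+m N M)))) P⊑W (≰⇒≥ not-short))
        where
        finish : u ^ M ++ v ^ N ++ u ^ N ⊑ P → Pal (reverse S ++ v ^ N ++ t)
        finish (d , eq) = centred (u ^ N ++ d) P≡ (⊑-++ (u ^ N) d) (proj₁ rest) (proj₂ rest)
          where
          P≡ : u ^ M ++ v ^ N ++ u ^ N ++ d ≡ P
          P≡ = begin
            u ^ M ++ v ^ N ++ u ^ N ++ d     ≡⟨ cong (u ^ M ++_) (++-assoc (v ^ N) (u ^ N) d) ⟨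
            u ^ M ++ (v ^ N ++ u ^ N) ++ d   ≡⟨ ++-assoc (u ^ M) _ d ⟨
            (u ^ M ++ v ^ N ++ u ^ N) ++ d   ≡⟨ eq ⟩
            P                                ∎
          rest : u ^ N ++ d ⊑ u ^ (M + N)
          rest = ++-cancel-⊑ {p = u ^ N ++ d} (v ^ N)
            (++-cancel-⊑ {p = v ^ N ++ u ^ N ++ d} (u ^ M) (subst (_⊑ W) (sym P≡) P⊑W))

  pal-centre : Pal (reverse (common L) ++ v ^ N ++ common R)
  pal-centre with rich⇒unioccurrent (++-≢[] (v ^ N ++ u ^ (M + N)) uᴹ≢[]) rich
  ... | P , palP , P⊑W , first = centre P palP P⊑W first

pal-axis : u ≢ [] → (R : Divergence u v) (L : Divergence (reverse u) (reverse v)) →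
  (∀ m n d → Rich (u ^ m ++ v ^ suc n ++ u ^ (m + d))) →
  let s = reverse (common L) ; t = common R in Pal (s ++ t) × Pal (s ++ v ++ t)
pal-axis {u = u} {v = v} u≢[] R L rich =
  reduce 0 z≤n , subst (λ h → Pal (s ++ h ++ t)) (++-identityʳ v) (reduce 1 (s≤s z≤n))
  where
  s = reverse (common L)
  t = common R
  n₁ = proj₁ (alongˡ R)
  n₂ = proj₁ (alongʳ R)
  n₃ = proj₁ (alongˡ L)
  n₄ = proj₁ (alongʳ L)
  -- The sum dominates the four exponents at which the divergences become visible.
  n = (n₁ + n₂) + (n₃ + n₄)
  -- As `u ^ m` has at least `m` letters, all but one of the `M` factors account for the length of
  -- `v ^ suc n ++ u ^ suc n`, and the remaining one for the extra `length u` in `wide`. The summand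
  -- `suc n` ensures that `M` is at least `suc n`.
  M = suc (length (v ^ suc n ++ u ^ suc n) + suc n)
  wide : length (v ^ suc n ++ u ^ suc n) + length u ≤ length (u ^ M)
  wide = subst₂ _≤_ (+-comm (length u) _) (sym (length-++ u))
    (+-monoʳ-≤ (length u) (≤-trans (m≤m+n _ (suc n)) (n≤length-^ u _ u≢[])))
  raise : ∀ {w z} (h : z ⊑ω w) → proj₁ h ≤ n → z ⊑ w ^ suc n
  raise {w = w} (_ , h) le = ⊑-trans h (^-mono-⊑ w (m≤n⇒m≤1+n le))
  pal : Pal (s ++ v ^ suc n ++ t)
  pal = Centre.pal-centre u≢[] R L {M} {suc n}
    (m≤n⇒m≤1+n (m≤n+m (suc n) _)) (⊑-++ u _) (⊑-++ u _) wide
    (raise (alongˡ R) (≤-trans (m≤m+n n₁ n₂) (m≤m+n _ _)))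
    (raise (alongʳ R) (≤-trans (m≤n+m n₂ n₁) (m≤m+n _ _)))
    (raise (alongˡ L) (≤-trans (m≤m+n n₃ n₄) (m≤n+m _ (n₁ + n₂))))
    (raise (alongʳ L) (≤-trans (m≤n+m n₄ n₃) (m≤n+m _ (n₁ + n₂))))
    (rich M n (suc n))
  reduce : ∀ m → m ≤ suc n → Pal (s ++ v ^ m ++ t)
  reduce m le = Pal-descend-to s t v m (suc n ∸ m) (⊑ω⇒⊑ (common-⊑ωʳ R))
    (subst (λ h → h ⊑ reverse v ++ h) (sym (reverse-involutive (common L))) (⊑ω⇒⊑ (common-⊑ωʳ L)))
    (subst (λ h → Pal (s ++ v ^ h ++ t)) (sym (m∸n+n≡m le)) pal)

-- The last three fields say that the anti-automorphism behind `fixed⇒commute` fixes the identity,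
-- `u` and `v`; asking for both words makes the notion symmetric.
record Axis (u v : Word k) : Set where
  field
    right : Divergence u v
    left  : Divergence (reverse u) (reverse v)

  s : Word k
  s = reverse (common left)

  t : Word k
  t = common right

  field
    pal-st  : Pal (s ++ t)
    pal-sut : Pal (s ++ u ++ t)
    pal-svt : Pal (s ++ v ++ t)

  size : ℕ
  size = length (common left) + length (common right)

Axis-sym : Axis u v → Axis v u
Axis-sym A = record
  { right = Divergence-sym right ; left = Divergence-sym left
  ; pal-st = pal-st ; pal-sut = pal-svt ; pal-svt = pal-sut }
  where open Axis A

applyM-replicate : ∀ (φ : Morphism k) a n → applyM φ (replicate n a) ≡ φ a ^ n
applyM-replicate φ a n = cong concat (map-replicate φ n a)

commute-reverse : ∀ (w z : Word k) → reverse w ++ z ≡ z ++ reverse w → w ++ reverse z ≡ reverse z ++ w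
commute-reverse w z eq = begin
  w ++ reverse z                       ≡⟨ cong (_++ reverse z) (reverse-involutive w) ⟨
  reverse (reverse w) ++ reverse z     ≡⟨ reverse-++ z (reverse w) ⟨
  reverse (z ++ reverse w)             ≡⟨ cong reverse eq ⟨
  reverse (reverse w ++ z)             ≡⟨ reverse-++ (reverse w) z ⟩
  reverse z ++ reverse (reverse w)     ≡⟨ cong (reverse z ++_) (reverse-involutive w) ⟩
  reverse z ++ w                       ∎

-- Here `(s , t)` serves `a` and `b`, `(s′ , t)` serves `a` and `c`, and `(s , t′)` serves `b` and
-- `c`. By `axis-shift` and primitivity, `t′` is `b ^ suc i ++ t` and `s′` is `s ++ a ^ suc j`, the
-- exponents being positive as the lengths differ. With `x` and `y` these powers of `a` and `b`, the
-- pair `(s , t)` then fixes `x`, `y`, `x ++ c` and `c ++ y`, and `fixed⇒commute` applies.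
crossing-axes : ∀ (a b c s t s′ t′ : Word k) → a ≢ [] → b ≢ [] → c ≢ [] → Primitive a → Primitive b → Primitive c →
  Pal (s ++ t) → Pal (s ++ a ++ t) → Pal (s ++ b ++ t) →
  Pal (s′ ++ t) → Pal (s′ ++ a ++ t) → Pal (s′ ++ c ++ t) →
  Pal (s ++ t′) → Pal (s ++ b ++ t′) → Pal (s ++ c ++ t′) →
  reverse s ⊑ reverse s′ → t ⊑ t′ → length s < length s′ → length t < length t′ →
  ∃ λ i → ∃ λ j → ∃ λ l → b ^ suc i ++ a ^ suc j ≡ c ^ suc l
crossing-axes {k} a b c s t s′ t′ a≢ b≢ c≢ pa pb pc st sat sbt s′t s′at s′ct st′ sbt′ sct′ s⊑ t⊑ s< t<
  with axis-shift s t b st sbt st′ sbt′ t⊑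
     -- The shift on the left is read backwards, which exchanges the roles of `s` and `t`.
     | axis-shift (reverse t) (reverse s) (reverse a) (Pal-reverse-++ s t st) (Pal-reverse-++₃ s a t sat)
         (Pal-reverse-++ s′ t s′t) (Pal-reverse-++₃ s′ a t s′at) s⊑
... | y , t′≡yt , by≡yb | x′ , rs′≡ , ax′≡
  with primitive-commute pb b≢ by≡yb | primitive-commute pa a≢ (commute-reverse a x′ ax′≡)
... | zero , y≡ | _ = contradiction (cong length (trans t′≡yt (cong (_++ t) y≡))) (>⇒≢ t<)
... | suc i , y≡ | zero , x≡ = contradiction (cong length s′≡) (>⇒≢ s<)
  where
  s′≡ : s′ ≡ s
  s′≡ = begin
    s′                                  ≡⟨ reverse-involutive s′ ⟨
    reverse (reverse s′)                ≡⟨ cong reverse rs′≡ ⟩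
    reverse (x′ ++ reverse s)           ≡⟨ reverse-++ x′ (reverse s) ⟩
    reverse (reverse s) ++ reverse x′   ≡⟨ cong₂ _++_ (reverse-involutive s) x≡ ⟩
    s ++ []                             ≡⟨ ++-identityʳ s ⟩
    s                                   ∎
... | suc i , y≡ | suc j , x≡ = i , j , power
  where
  x y₀ : Word k
  x = a ^ suc j
  y₀ = b ^ suc i
  s′≡ : s′ ≡ s ++ x
  s′≡ = begin
    s′                                  ≡⟨ reverse-involutive s′ ⟨
    reverse (reverse s′)                ≡⟨ cong reverse rs′≡ ⟩
    reverse (x′ ++ reverse s)           ≡⟨ reverse-++ x′ (reverse s) ⟩
    reverse (reverse s) ++ reverse x′   ≡⟨ cong₂ _++_ (reverse-involutive s) x≡ ⟩
    s ++ x                              ∎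
  t′≡ : t′ ≡ y₀ ++ t
  t′≡ = trans t′≡yt (cong (_++ t) y≡)
  commutes : c ++ y₀ ++ x ≡ (y₀ ++ x) ++ c
  commutes = fixed⇒commute s t x y₀ c st
    (subst Pal (trans (cong (_++ t) s′≡) (++-assoc s x t)) s′t)
    (subst Pal (cong (s ++_) t′≡) st′)
    (subst Pal (trans (cong (_++ c ++ t) s′≡) (trans (++-assoc s x (c ++ t)) (cong (s ++_) (sym (++-assoc x c t))))) s′ct)
    (subst Pal (trans (cong (λ h → s ++ c ++ h) t′≡) (cong (s ++_) (sym (++-assoc c y₀ t)))) sct′)
  power : ∃ λ l → y₀ ++ x ≡ c ^ suc l
  power with primitive-commute pc c≢ commutes
  ... | zero  , eq = contradiction eq (++-≢[] x (++-≢[] (b ^ i) b≢))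
  ... | suc l , eq = l , eq

-- The triple condition in the free group.

negative : Word k → GWord k
negative = map (λ a → a , false)

ginv-embed : ∀ (w : Word k) → ginv (embed w) ≡ negative (reverse w)
ginv-embed w = trans (cong reverse (sym (map-∘ w))) (sym (reverse-map _ w))

freeReduce-negative : ∀ (h : Word k) → freeReduce (negative h) ≡ negative h
freeReduce-negative [] = refl
freeReduce-negative (x ∷ []) = refl
freeReduce-negative (x ∷ y ∷ h) rewrite freeReduce-negative (y ∷ h) with x Fin.≟ y
... | yes _ = refl
... | no  _ = refl

-- The tail `h` makes the induction go through: removing the first letter of `w` hands its inverse
-- over to `h`, where the final `push` cancels it.
freeReduce-cancel : ∀ (w h : Word k) → freeReduce (embed w ++ negative (reverse w ++ h)) ≡ negative h
freeReduce-cancel []      h = freeReduce-negative h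
freeReduce-cancel (x ∷ w) h
  rewrite unfold-reverse x w | ++-assoc (reverse w) [ x ] h | freeReduce-cancel w (x ∷ h) with x Fin.≟ x
... | yes _   = refl
... | no  x≢x = contradiction refl x≢x

gpow-embed : ∀ (w : Word k) n → gpow (embed w) (ℤ.+ n) ≡ embed (w ^ n)
gpow-embed w zero    = refl
gpow-embed w (suc n) = trans (cong (embed w ++_) (gpow-embed w n)) (sym (map-++ _ w (w ^ n)))

gpow-negative : ∀ (w : Word k) n → gpow (embed w) ℤ.-[1+ n ] ≡ negative (reverse (w ^ suc n))
gpow-negative w n = begin
  ginv (embed w) ^′ suc n         ≡⟨ cong (_^′ suc n) (ginv-embed w) ⟩
  negative (reverse w) ^′ suc n   ≡⟨ negative-^ (suc n) ⟩
  negative (reverse w ^ suc n)    ≡⟨ cong negative (reverse-^ w (suc n)) ⟨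
  negative (reverse (w ^ suc n))  ∎
  where
  _^′_ : GWord _ → ℕ → GWord _
  g ^′ n = concat (replicate n g)
  negative-^ : ∀ n → negative (reverse w) ^′ n ≡ negative (reverse w ^ n)
  negative-^ zero    = refl
  negative-^ (suc n) = trans (cong (negative (reverse w) ++_) (negative-^ n)) (sym (map-++ _ (reverse w) _))

-- Such an equation is a relation in the free group with exponents i+1, j+1 and -(l+1), whose
-- product is nonzero.
triple⇒no-power : ∀ (φ : Morphism k) → TripleCondition φ → ∀ {a b c} → a ≢ b → b ≢ c → a ≢ c →
  ∀ i j l → φ a ^ suc i ++ φ b ^ suc j ≢ φ c ^ suc l
triple⇒no-power φ triple {a} {b} {c} a≢b b≢c a≢c i j l eq =
  nonzero (triple a b c a≢b b≢c a≢c (ℤ.+ suc i) (ℤ.+ suc j) ℤ.-[1+ l ] trivial)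
  where
  nonzero : ℤ.+ suc i ℤ.* ℤ.+ suc j ℤ.* ℤ.-[1+ l ] ≢ ℤ.+ 0
  nonzero ()
  trivial : IsTrivial (gpow (embed (φ a)) (ℤ.+ suc i) ++ gpow (embed (φ b)) (ℤ.+ suc j) ++ gpow (embed (φ c)) ℤ.-[1+ l ])
  trivial = begin
    freeReduce (gpow (embed (φ a)) (ℤ.+ suc i) ++ gpow (embed (φ b)) (ℤ.+ suc j) ++ gpow (embed (φ c)) ℤ.-[1+ l ])
      ≡⟨ cong freeReduce (cong₂ _++_ (gpow-embed (φ a) (suc i))
          (cong₂ _++_ (gpow-embed (φ b) (suc j)) (gpow-negative (φ c) l))) ⟩
    freeReduce (embed (φ a ^ suc i) ++ embed (φ b ^ suc j) ++ negative (reverse (φ c ^ suc l)))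
      ≡⟨ cong freeReduce (++-assoc (embed (φ a ^ suc i)) _ _) ⟨
    freeReduce ((embed (φ a ^ suc i) ++ embed (φ b ^ suc j)) ++ negative (reverse (φ c ^ suc l)))
      ≡⟨ cong (λ h → freeReduce (h ++ negative (reverse (φ c ^ suc l))))
          (trans (sym (map-++ _ (φ a ^ suc i) _)) (cong embed eq)) ⟩
    freeReduce (embed (φ c ^ suc l) ++ negative (reverse (φ c ^ suc l)))
      ≡⟨ cong (λ h → freeReduce (embed (φ c ^ suc l) ++ negative h)) (++-identityʳ _) ⟨
    freeReduce (embed (φ c ^ suc l) ++ negative (reverse (φ c ^ suc l) ++ []))
      ≡⟨ freeReduce-cancel (φ c ^ suc l) [] ⟩
    [] ∎

-- Combining the axes of all pairs of letters

-- The ultrametric law for common prefixes of three periodic words: the least of the three lengths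
-- occurs at least twice.
Isosceles : ℕ → ℕ → ℕ → Set
Isosceles x y z = ¬ (x < y × x < z) × ¬ (y < x × y < z) × ¬ (z < x × z < y)

Isosceles-swap : ∀ {x y z} → Isosceles x y z → Isosceles x z y
Isosceles-swap (f , g , h) = (λ e → f (swap e)) , h , g

-- If `s₂ < s₁`, the law gives `s₃ < s₁` as well; as the first sum is minimal, `t₁` would then lie
-- strictly below both `t₂` and `t₃`.
minimal-≤ : ∀ {s₁ s₂ s₃ t₁ t₂ t₃} → Isosceles s₁ s₂ s₃ → Isosceles t₁ t₂ t₃ →
  s₁ + t₁ ≤ s₂ + t₂ → s₁ + t₁ ≤ s₃ + t₃ → s₁ ≤ s₂
minimal-≤ {s₁} {s₂} {s₃} {t₁} (_ , g , _) (f , _) le₂ le₃ = ≮⇒≥ λ s₂<s₁ →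
  f (compensate le₂ s₂<s₁ , compensate le₃ (≰⇒> λ s₁≤s₃ → g (s₂<s₁ , <-≤-trans s₂<s₁ s₁≤s₃)))
  where
  compensate : ∀ {s t} → s₁ + t₁ ≤ s + t → s < s₁ → t₁ < t
  compensate le s< = ≰⇒> λ t≤ → <⇒≱ (+-mono-<-≤ s< t≤) le

-- The indices 1, 2, 3 stand for the pairs ab, ac, bc. In the `same` cases the axis of ab also
-- serves c; in the `cross` cases c agrees longer with one of a, b on the left and with the other on
-- the right.
data Position (s₁ s₂ s₃ t₁ t₂ t₃ : ℕ) : Set where
  same₂  : s₁ ≡ s₂ → t₁ ≡ t₂ → Position s₁ s₂ s₃ t₁ t₂ t₃
  same₃  : s₁ ≡ s₃ → t₁ ≡ t₃ → Position s₁ s₂ s₃ t₁ t₂ t₃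
  cross₂ : s₁ < s₂ → t₁ ≡ t₂ → s₁ ≡ s₃ → t₁ < t₃ → Position s₁ s₂ s₃ t₁ t₂ t₃
  cross₃ : s₁ < s₃ → t₁ ≡ t₃ → s₁ ≡ s₂ → t₁ < t₂ → Position s₁ s₂ s₃ t₁ t₂ t₃

position : ∀ {s₁ s₂ s₃ t₁ t₂ t₃} → Isosceles s₁ s₂ s₃ → Isosceles t₁ t₂ t₃ →
  s₁ + t₁ ≤ s₂ + t₂ → s₁ + t₁ ≤ s₃ + t₃ → Position s₁ s₂ s₃ t₁ t₂ t₃
position {s₁} {s₂} {s₃} {t₁} {t₂} {t₃} S T le₂ le₃
  with m≤n⇒m<n∨m≡n s₁≤s₂ | m≤n⇒m<n∨m≡n s₁≤s₃ | m≤n⇒m<n∨m≡n t₁≤t₂ | m≤n⇒m<n∨m≡n t₁≤t₃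
  where
  s₁≤s₂ = minimal-≤ S T le₂ le₃
  s₁≤s₃ = minimal-≤ (Isosceles-swap S) (Isosceles-swap T) le₃ le₂
  le₂′ = subst₂ _≤_ (+-comm s₁ t₁) (+-comm s₂ t₂) le₂
  le₃′ = subst₂ _≤_ (+-comm s₁ t₁) (+-comm s₃ t₃) le₃
  t₁≤t₂ = minimal-≤ T S le₂′ le₃′
  t₁≤t₃ = minimal-≤ (Isosceles-swap T) (Isosceles-swap S) le₃′ le₂′
... | inj₁ a | inj₁ b | _      | _      = contradiction (a , b) (proj₁ S)
... | _      | _      | inj₁ a | inj₁ b = contradiction (a , b) (proj₁ T)
... | inj₂ a | _      | inj₂ b | _      = same₂ a b
... | _      | inj₂ a | _      | inj₂ b = same₃ a b
... | inj₁ a | inj₂ b | inj₂ c | inj₁ d = cross₂ a c b d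
... | inj₂ a | inj₁ b | inj₁ c | inj₂ d = cross₃ b d a c

divergence-isosceles : (d : Divergence u v) (e : Divergence u w) (f : Divergence v w) →
  Isosceles (length (common d)) (length (common e)) (length (common f))
divergence-isosceles d e f = ultrametric d e f , ultrametric e d (Divergence-sym f) ,
  λ (fd , fe) → ultrametric f (Divergence-sym d) (Divergence-sym e) (fd , fe)

module _ (φ : Morphism k) (ne : NonErasing φ) (inj : InjectiveOnLetters φ) (prim : ∀ x → Primitive (φ x))
  (triple : TripleCondition φ) (pres : PreservesRichness φ) where

  open Axis

  rich-image : ∀ {a b} → a ≢ b → ∀ m n d → Rich (φ a ^ m ++ φ b ^ suc n ++ φ a ^ (m + d))
  rich-image {a} {b} a≢b m n d = subst Rich image (proj₁ pres (x ++ y ++ x′) (rich-aba a≢b m n d))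
    where
    x = replicate m a
    y = replicate (suc n) b
    x′ = replicate (m + d) a
    image : applyM φ (x ++ y ++ x′) ≡ φ a ^ m ++ φ b ^ suc n ++ φ a ^ (m + d)
    image = trans (concatMap-++ φ x (y ++ x′)) (cong₂ _++_ (applyM-replicate φ a m)
      (trans (concatMap-++ φ y x′) (cong₂ _++_ (applyM-replicate φ b (suc n)) (applyM-replicate φ a (m + d)))))

  axis : ∀ a b → a ≢ b → Axis (φ a) (φ b)
  axis a b a≢b = record
    { right = R ; left = L ; pal-st = proj₁ ab ; pal-sut = proj₂ ba ; pal-svt = proj₂ ab }
    where
    noncommute : φ a ++ φ b ≢ φ b ++ φ a
    noncommute = primitive-noncommute (ne a) (ne b) (prim a) (prim b) (inj a b a≢b)
    R : Divergence (φ a) (φ b)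
    R = diverge (ne a) (ne b) noncommute
    L : Divergence (reverse (φ a)) (reverse (φ b))
    L = diverge (reverse-≢[] (ne a)) (reverse-≢[] (ne b)) λ eq → noncommute (sym (reverse-injective
      (trans (reverse-++ (φ b) (φ a)) (trans eq (sym (reverse-++ (φ a) (φ b)))))))
    ab = pal-axis (ne a) R L (rich-image a≢b)
    -- Exchanging the letters keeps the common words and supplies the palindrome around `φ a`.
    ba = pal-axis (ne b) (Divergence-sym R) (Divergence-sym L) (rich-image (λ e → a≢b (sym e)))

  -- Equal lengths give equal words, as both begin the same periodic word. So the three axes share
  -- sides as `crossing-axes` requires, and the relation it yields contradicts the triple condition.
  no-crossing : ∀ {a b c} → a ≢ b → b ≢ c → a ≢ c →
    (A : Axis (φ a) (φ b)) (B : Axis (φ a) (φ c)) (C : Axis (φ b) (φ c)) →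
    length (common (left A)) < length (common (left B)) → length (common (right A)) ≡ length (common (right B)) →
    length (common (left A)) ≡ length (common (left C)) → length (common (right A)) < length (common (right C)) → ⊥
  no-crossing {a} {b} {c} a≢b b≢c a≢c A B C s< t≡ s≡ t< =
    let i , j , l , eq = crossing-axes (φ a) (φ b) (φ c) (s A) (t A) (s B) (t C)
          (ne a) (ne b) (ne c) (prim a) (prim b) (prim c) (pal-st A) (pal-sut A) (pal-svt A)
          (subst (λ h → Pal (s B ++ h)) (sym tA≡tB) (pal-st B))
          (subst (λ h → Pal (s B ++ φ a ++ h)) (sym tA≡tB) (pal-sut B))
          (subst (λ h → Pal (s B ++ φ c ++ h)) (sym tA≡tB) (pal-svt B))
          (subst (λ h → Pal (h ++ t C)) (sym sA≡sC) (pal-st C))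
          (subst (λ h → Pal (h ++ φ b ++ t C)) (sym sA≡sC) (pal-sut C))
          (subst (λ h → Pal (h ++ φ c ++ t C)) (sym sA≡sC) (pal-svt C))
          (subst₂ _⊑_ (sym (reverse-involutive _)) (sym (reverse-involutive _))
            (⊑ω-comparable (common-⊑ωˡ (left A)) (common-⊑ωˡ (left B)) (<⇒≤ s<)))
          (⊑ω-comparable (common-⊑ωʳ (right A)) (common-⊑ωˡ (right C)) (<⇒≤ t<))
          (subst₂ _<_ (sym (length-reverse (common (left A)))) (sym (length-reverse (common (left B)))) s<) t<
    in triple⇒no-power φ triple (λ e → a≢b (sym e)) a≢c b≢c i j l eq
    where
    tA≡tB : t A ≡ t B
    tA≡tB = ⊑ω-unique (common-⊑ωˡ (right A)) (common-⊑ωˡ (right B)) t≡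
    sA≡sC : s A ≡ s C
    sA≡sC = cong reverse (⊑ω-unique (common-⊑ωʳ (left A)) (common-⊑ωˡ (left C)) s≡)

  same-axis : ∀ {a b c} (A : Axis (φ a) (φ b)) (B : Axis (φ a) (φ c)) →
    length (common (left A)) ≡ length (common (left B)) → length (common (right A)) ≡ length (common (right B)) →
    Pal (s A ++ φ c ++ t A) × t A ⊑ φ c ++ t A
  same-axis {c = c} A B s≡ t≡ =
    subst₂ (λ g h → Pal (g ++ φ c ++ h)) (cong reverse (sym sA≡sB)) (sym tA≡tB) (pal-svt B) ,
    subst (λ h → h ⊑ φ c ++ h) (sym tA≡tB) (⊑ω⇒⊑ (common-⊑ωʳ (right B)))
    where
    tA≡tB : t A ≡ t B
    tA≡tB = ⊑ω-unique (common-⊑ωˡ (right A)) (common-⊑ωˡ (right B)) t≡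
    sA≡sB : common (left A) ≡ common (left B)
    sA≡sB = ⊑ω-unique (common-⊑ωˡ (left A)) (common-⊑ωˡ (left B)) s≡

  MinimalAxis : Set
  MinimalAxis = ∃ λ a → ∃ λ b → Σ (a ≢ b) λ a≢b →
    ∀ c d (c≢d : c ≢ d) → size (axis a b a≢b) ≤ size (axis c d c≢d)

  -- Descent to strictly smaller axes, with `n` bounding the size; over a finite alphabet the
  -- existence of a smaller one is decidable.
  minimal-axis : ∀ n a b (a≢b : a ≢ b) → size (axis a b a≢b) ≤ n → MinimalAxis
  minimal-axis n a b a≢b le with Fin.any? (λ c → Fin.any? (λ d → smaller? c d))
    where
    smaller? : ∀ c d → Dec (Σ (c ≢ d) λ c≢d → size (axis c d c≢d) < size (axis a b a≢b))
    smaller? c d with c Fin.≟ d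
    ... | yes c≡d = no λ (c≢d , _) → c≢d c≡d
    ... | no  c≢d with size (axis c d c≢d) <? size (axis a b a≢b)
    ... | yes lt = yes (c≢d , lt)
    ... | no  ≮  = no λ (_ , lt) → ≮ lt
  ... | no none = a , b , a≢b , λ c d c≢d → ≮⇒≥ λ lt → none (c , d , c≢d , lt)
  minimal-axis zero    a b a≢b le | yes (c , d , c≢d , lt) = contradiction (<-≤-trans lt le) n≮0
  minimal-axis (suc n) a b a≢b le | yes (c , d , c≢d , lt) = minimal-axis n c d c≢d (≤-pred (<-≤-trans lt le))

  minimal⇒classP : MinimalAxis → ClassP φ
  minimal⇒classP (a , b , a≢b , min) = classP φ ne (s A) (t A) (pal-st A) image
    where
    A = axis a b a≢b
    image : ∀ c → Pal (s A ++ φ c ++ t A) × t A ⊑ φ c ++ t A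
    image c with c Fin.≟ a | c Fin.≟ b
    ... | yes refl | _ = pal-sut A , ⊑ω⇒⊑ (common-⊑ωˡ (right A))
    ... | no _ | yes refl = pal-svt A , ⊑ω⇒⊑ (common-⊑ωʳ (right A))
    ... | no c≢a | no c≢b = conclude (position
        (divergence-isosceles (left A) (left B) (left C)) (divergence-isosceles (right A) (right B) (right C))
        (min a c a≢c) (min b c b≢c))
      where
      a≢c : a ≢ c
      a≢c e = c≢a (sym e)
      b≢c : b ≢ c
      b≢c e = c≢b (sym e)
      B = axis a c a≢c
      C = axis b c b≢c
      conclude : _ → Pal (s A ++ φ c ++ t A) × t A ⊑ φ c ++ t A
      conclude (same₂ s≡ t≡) = same-axis A B s≡ t≡
      conclude (same₃ s≡ t≡) = same-axis (Axis-sym A) C s≡ t≡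
      conclude (cross₂ s< t≡ s≡ t<) = ⊥-elim (no-crossing a≢b b≢c a≢c A B C s< t≡ s≡ t<)
      -- The previous case with `a` and `b` exchanged.
      conclude (cross₃ s< t≡ s≡ t<) = ⊥-elim (no-crossing (λ e → a≢b (sym e)) a≢c b≢c (Axis-sym A) C B s< t≡ s≡ t<)

-- Alphabets with at most one letter, and the conclusion.

unary-Pal : ∀ (w : Word 1) → Pal w
unary-Pal w = subst Pal (sym (unary w)) (reverse-replicate (length w) zero)
  where
  unary : ∀ (w : Word 1) → w ≡ replicate (length w) zero
  unary []         = refl
  unary (zero ∷ w) = cong (zero ∷_) (unary w)

theorem6p29 : ∀ (k : ℕ) (φ : Morphism k) → NonErasing φ → InjectiveOnLetters φ →
    (∀ x → Primitive (φ x)) → TripleCondition φ → PreservesRichness φ → ClassP φ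
-- With fewer than two letters there is no pair to choose; empty `s` and `t` work because every word
-- over one letter is a palindrome.
theorem6p29 zero φ ne _ _ _ _ = classP φ ne [] [] refl λ ()
theorem6p29 (suc zero) φ ne _ _ _ _ = classP φ ne [] [] refl λ x → unary-Pal _ , (_ , refl)
theorem6p29 (suc (suc k)) φ ne inj prim triple pres =
  minimal⇒classP φ ne inj prim triple pres (minimal-axis φ ne inj prim triple pres _ zero (suc zero) (λ ()) ≤-refl)
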